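{- Let $\mathcal X,\mathcal Y_1,\mathcal Y_2,\mathcal W$ be finite nonempty sets and $g:\mathcal W\times\mathcal X\to[0,1]$ a gain function. For any prior $\pi$ on $\mathcal X$ with $V_g(\pi)>0$ and any two channels $(\mathcal X,\mathcal Y_1,C_1)$ and $(\mathcal X,\mathcal Y_2,C_2)$, $$I_g(\pi,C_1\parallel C_2)\ \le\ I_g(\pi,C_1)+I_g(\pi,C_2)+H_g^{\min}(\pi)-H_g(\pi).$$
   Context: A (discrete) channel $(\mathcal X,\mathcal Y,C)$ consists of finite sets $\mathcal X,\mathcal Y$ and a matrix $C$ with entries $C[x,y]\ge 0$ and $\sum_{y}C[x,y]=1$ for each $x$. A prior on $\mathcal X$ is a probability distribution on $\mathcal X$. The parallel composition with shared input $C_1\parallel C_2$ is the channel from $\mathcal X$ to $\mathcal Y_1\times\mathcal Y_2$ with $(C_1\parallel C_2)[x,(y_1,y_2)]=C_1[x,y_1]\,C_2[x,y_2]$. $V_g(\pi)=\max_{w\in\mathcal W}\sum_{x}\pi[x]g(w,x)$, $V_g(\pi,C)=\sum_{y}\max_{w\in\mathcal W}\sum_x\pi[x]C[x,y]g(w,x)$, $H_g(\pi)=-\log V_g(\pi)$, $H_g(\pi,C)=-\log V_g(\pi,C)$, and the $g$-leakage is $I_g(\pi,C)=H_g(\pi)-H_g(\pi,C)$. Logarithms are to base 2. $H_g^{\min}(\pi)=-\log\min\{\pi[x]g(w,x): x\in\mathcal X,\ w\in\mathcal W,\ \pi[x]g(w,x)\ne0\}$. -}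

module Defs where

open import Algebra.Bundles using (CommutativeRing)
open import Data.Fin using (Fin; zero; suc; _↑ˡ_; _↑ʳ_; remQuot)
import Data.Fin.Properties as Finₚ
open import Data.Integer as ℤ using (ℤ; +_; -[1+_])
import Data.Integer.Properties as ℤₚ
open import Data.Integer.Tactic.RingSolver using () renaming (solve-∀ to ℤ-solve)
open import Data.Nat as ℕ using (ℕ; zero; suc; 2+; _^_)
open import Data.Nat.Logarithm
  using (⌊log₂_⌋; ⌊log₂⌋-mono-≤; ⌊log₂[2^n]⌋≡n; ⌊log₂⌊n/2⌋⌋≡⌊log₂n⌋∸1)
import Data.Nat.Properties as ℕₚ
open import Data.Nat.Tactic.RingSolver using () renaming (solve-∀ to ℕ-solve)
open import Data.Product using (_,_; _×_; ∃-syntax; proj₁; proj₂)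
open import Data.Product.Function.NonDependent.Propositional using (_×-↔_)
open import Data.Rational as ℚ using (ℚ; mkℚ; 0ℚ; 1ℚ; ½; ↥_; ↧ₙ_)
import Data.Rational.Properties as ℚₚ
open import Data.Rational.Unnormalised as ℚᵘ using (mkℚᵘ)
import Data.Rational.Unnormalised.Properties as ℚᵘₚ
open import Data.Sum using (_⊎_; inj₁; inj₂)
open import Function using (_∘_; _↔_; Inverse)
open import Function.Construct.Composition using (_↔-∘_)
open import Function.Construct.Symmetry using (↔-sym)
open import Level using (0ℓ)
open import Relation.Binary.PropositionalEquality as ≡
  using (_≡_; refl; cong; cong₂; subst; subst₂)
import Relation.Binary.Reasoning.Setoid
open import Relation.Nullary using (¬_; yes; no; contradiction; ¬¬-excluded-middle)
open import Relation.Nullary.Decidable using (dec⇒maybe)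
open import Tactic.RingSolver using () renaming (solve-∀ to ring-solve)
import Tactic.RingSolver.Core.AlmostCommutativeRing as ACR

<2^⇒⌊log₂⌋< : ∀ l n → .{{ℕ.NonZero n}} → n ℕ.< 2 ^ l → ⌊log₂ n ⌋ ℕ.< l
<2^⇒⌊log₂⌋< zero    (suc n)       (ℕ.s≤s ())
<2^⇒⌊log₂⌋< (suc l) 1             _ = ℕ.s≤s ℕ.z≤n
<2^⇒⌊log₂⌋< (suc l) n@(2+ m) n<2^ = ℕ.s≤s (begin
    ⌊log₂ n ⌋                    ≤⟨ ℕₚ.m≤n+m∸n _ 1 ⟩
    suc (⌊log₂ n ⌋ ℕ.∸ 1)        ≡⟨ cong suc (⌊log₂⌊n/2⌋⌋≡⌊log₂n⌋∸1 n) ⟨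
    suc ⌊log₂ ℕ.⌊ n /2⌋ ⌋        ≤⟨ <2^⇒⌊log₂⌋< l ℕ.⌊ n /2⌋ half< ⟩
    l                            ∎)
  where
  open ℕₚ.≤-Reasoning
  half< : ℕ.⌊ n /2⌋ ℕ.< 2 ^ l
  half< = ℕₚ.*-cancelˡ-< 2 _ _ (begin-strict
    2 ℕ.* ℕ.⌊ n /2⌋              ≡⟨ cong (ℕ.⌊ n /2⌋ ℕ.+_) (ℕₚ.+-identityʳ _) ⟩
    ℕ.⌊ n /2⌋ ℕ.+ ℕ.⌊ n /2⌋      ≤⟨ ℕₚ.+-monoʳ-≤ ℕ.⌊ n /2⌋ (ℕₚ.⌊n/2⌋≤⌈n/2⌉ n) ⟩
    ℕ.⌊ n /2⌋ ℕ.+ ℕ.⌈ n /2⌉      ≡⟨ ℕₚ.⌊n/2⌋+⌈n/2⌉≡n n ⟩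
    n                            <⟨ n<2^ ⟩
    2 ^ suc l                    ∎)

2^⌊log₂⌋≤ : ∀ n → .{{ℕ.NonZero n}} → 2 ^ ⌊log₂ n ⌋ ℕ.≤ n
2^⌊log₂⌋≤ n with 2 ^ ⌊log₂ n ⌋ ℕ.≤? n
... | yes p = p
... | no ¬p = contradiction (<2^⇒⌊log₂⌋< _ n (ℕₚ.≰⇒> ¬p)) (ℕₚ.<-irrefl refl)

≤2^1+⌊log₂⌋ : ∀ n → n ℕ.≤ 2 ^ suc ⌊log₂ n ⌋
≤2^1+⌊log₂⌋ n with n ℕ.≤? 2 ^ suc ⌊log₂ n ⌋
... | yes p = p
... | no ¬p = contradiction
  (subst (ℕ._≤ ⌊log₂ n ⌋) (⌊log₂[2^n]⌋≡n (suc ⌊log₂ n ⌋)) (⌊log₂⌋-mono-≤ (ℕₚ.<⇒≤ (ℕₚ.≰⇒> ¬p))))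
  (ℕₚ.<-irrefl refl)

2^-cancel-≤ : ∀ m n → 2 ^ m ℕ.≤ 2 ^ n → m ℕ.≤ n
2^-cancel-≤ m n p = subst₂ ℕ._≤_ (⌊log₂[2^n]⌋≡n m) (⌊log₂[2^n]⌋≡n n) (⌊log₂⌋-mono-≤ p)

^-distribʳ-* : ∀ k m n → (m ℕ.* n) ^ k ≡ m ^ k ℕ.* n ^ k
^-distribʳ-* zero    m n = refl
^-distribʳ-* (suc k) m n = ≡.trans (cong (m ℕ.* n ℕ.*_) (^-distribʳ-* k m n)) (lemma m n (m ^ k) (n ^ k))
  where
  lemma : ∀ a b c d → a ℕ.* b ℕ.* (c ℕ.* d) ≡ a ℕ.* c ℕ.* (b ℕ.* d)
  lemma = ℕ-solve

-- Bernoulli: (1 - 1/T)^j ≥ 1 - j/T  with T = suc v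
bernoulli : ∀ v j → suc v ^ j ℕ.* suc v ℕ.≤ v ^ j ℕ.* suc v ℕ.+ j ℕ.* suc v ^ j
bernoulli v zero    = ℕₚ.m≤m+n _ 0
bernoulli v (suc j) = begin
    T ℕ.* t ℕ.* T                                      ≡⟨ ℕₚ.*-assoc T t T ⟩
    T ℕ.* (t ℕ.* T)                                    ≤⟨ ℕₚ.*-monoʳ-≤ T (bernoulli v j) ⟩
    T ℕ.* (u ℕ.* T ℕ.+ j ℕ.* t)                        ≡⟨ eq v u j t ⟩
    v ℕ.* u ℕ.* T ℕ.+ j ℕ.* (T ℕ.* t) ℕ.+ T ℕ.* u      ≤⟨ ℕₚ.+-monoʳ-≤ (v ℕ.* u ℕ.* T ℕ.+ j ℕ.* (T ℕ.* t)) (ℕₚ.*-monoʳ-≤ T (ℕₚ.^-monoˡ-≤ j (ℕₚ.n≤1+n v))) ⟩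
    v ℕ.* u ℕ.* T ℕ.+ j ℕ.* (T ℕ.* t) ℕ.+ T ℕ.* t      ≡⟨ eq′ (v ℕ.* u ℕ.* T) j (T ℕ.* t) ⟩
    v ℕ.* u ℕ.* T ℕ.+ suc j ℕ.* (T ℕ.* t)              ∎
  where
  open ℕₚ.≤-Reasoning
  T = suc v
  t = T ^ j
  u = v ^ j
  eq : ∀ v u j t → suc v ℕ.* (u ℕ.* suc v ℕ.+ j ℕ.* t) ≡
       v ℕ.* u ℕ.* suc v ℕ.+ j ℕ.* (suc v ℕ.* t) ℕ.+ suc v ℕ.* u
  eq = ℕ-solve
  eq′ : ∀ a j b → a ℕ.+ j ℕ.* b ℕ.+ b ≡ a ℕ.+ suc j ℕ.* b
  eq′ = ℕ-solve

-- (1 - 1/2k)^k ≥ 1/2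
half-power : ∀ k v → .{{ℕ.NonZero k}} → suc v ≡ k ℕ.+ k → suc v ^ k ℕ.≤ 2 ℕ.* v ^ k
half-power k v eq = ℕₚ.*-cancelˡ-≤ k (ℕₚ.+-cancelʳ-≤ (k ℕ.* t) _ _ (begin
    k ℕ.* t ℕ.+ k ℕ.* t                  ≡⟨ ≡.trans (e₁ k t) (cong (t ℕ.*_) (≡.sym eq)) ⟩
    t ℕ.* suc v                          ≤⟨ bernoulli v k ⟩
    u ℕ.* suc v ℕ.+ k ℕ.* t              ≡⟨ cong (ℕ._+ k ℕ.* t) (≡.trans (cong (u ℕ.*_) eq) (e₂ k u)) ⟩
    k ℕ.* (2 ℕ.* u) ℕ.+ k ℕ.* t          ∎))
  where
  open ℕₚ.≤-Reasoning
  t = suc v ^ k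
  u = v ^ k
  e₁ : ∀ k t → k ℕ.* t ℕ.+ k ℕ.* t ≡ t ℕ.* (k ℕ.+ k)
  e₁ = ℕ-solve
  e₂ : ∀ k u → u ℕ.* (k ℕ.+ k) ≡ k ℕ.* (2 ℕ.* u)
  e₂ = ℕ-solve

-- integer form of  log₂(a/b) ≤ log₂(c/d) + 1/k + 1/M + 1/N
⌊log₂⌋-compare : ∀ a b c d k M N → .{{ℕ.NonZero a}} → .{{ℕ.NonZero b}} → .{{ℕ.NonZero c}} → .{{ℕ.NonZero d}} →
  (a ℕ.* d) ^ k ℕ.≤ 2 ℕ.* (c ℕ.* b) ^ k →
  ⌊log₂ a ^ M ⌋ ℕ.* (k ℕ.* N) ℕ.+ ⌊log₂ d ^ N ⌋ ℕ.* (k ℕ.* M) ℕ.≤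
  M ℕ.* N ℕ.+ (suc ⌊log₂ c ^ N ⌋ ℕ.* (k ℕ.* M) ℕ.+ suc ⌊log₂ b ^ M ⌋ ℕ.* (k ℕ.* N))
⌊log₂⌋-compare a b c d k M N h = 2^-cancel-≤ _ _ (begin
    2 ^ (A ℕ.* (k ℕ.* N) ℕ.+ D ℕ.* (k ℕ.* M))                 ≡⟨ ℕₚ.^-distribˡ-+-* 2 (A ℕ.* (k ℕ.* N)) (D ℕ.* (k ℕ.* M)) ⟩
    2 ^ (A ℕ.* (k ℕ.* N)) ℕ.* 2 ^ (D ℕ.* (k ℕ.* M))           ≡⟨ cong₂ ℕ._*_ (ℕₚ.^-*-assoc 2 A _) (ℕₚ.^-*-assoc 2 D _) ⟨
    (2 ^ A) ^ (k ℕ.* N) ℕ.* (2 ^ D) ^ (k ℕ.* M)               ≤⟨ ℕₚ.*-mono-≤ (ℕₚ.^-monoˡ-≤ (k ℕ.* N) (2^⌊log₂⌋≤ (a ^ M) {{ℕₚ.m^n≢0 a M}}))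
                                                                              (ℕₚ.^-monoˡ-≤ (k ℕ.* M) (2^⌊log₂⌋≤ (d ^ N) {{ℕₚ.m^n≢0 d N}})) ⟩
    (a ^ M) ^ (k ℕ.* N) ℕ.* (d ^ N) ^ (k ℕ.* M)               ≡⟨ gather a d ⟩
    ((a ℕ.* d) ^ k) ^ (M ℕ.* N)                               ≤⟨ ℕₚ.^-monoˡ-≤ (M ℕ.* N) h ⟩
    (2 ℕ.* (c ℕ.* b) ^ k) ^ (M ℕ.* N)                         ≡⟨ ^-distribʳ-* (M ℕ.* N) 2 _ ⟩
    2 ^ (M ℕ.* N) ℕ.* ((c ℕ.* b) ^ k) ^ (M ℕ.* N)             ≡⟨ cong (λ z → 2 ^ (M ℕ.* N) ℕ.* (z ^ k) ^ (M ℕ.* N)) (ℕₚ.*-comm c b) ⟩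
    2 ^ (M ℕ.* N) ℕ.* ((b ℕ.* c) ^ k) ^ (M ℕ.* N)             ≡⟨ cong (2 ^ (M ℕ.* N) ℕ.*_) (≡.trans (≡.sym (gather b c)) (ℕₚ.*-comm _ ((c ^ N) ^ (k ℕ.* M)))) ⟩
    2 ^ (M ℕ.* N) ℕ.* ((c ^ N) ^ (k ℕ.* M) ℕ.* (b ^ M) ^ (k ℕ.* N)) ≤⟨ ℕₚ.*-monoʳ-≤ (2 ^ (M ℕ.* N)) (ℕₚ.*-mono-≤ (ℕₚ.^-monoˡ-≤ (k ℕ.* M) (≤2^1+⌊log₂⌋ (c ^ N)))
                                                                              (ℕₚ.^-monoˡ-≤ (k ℕ.* N) (≤2^1+⌊log₂⌋ (b ^ M)))) ⟩
    2 ^ (M ℕ.* N) ℕ.* ((2 ^ suc C) ^ (k ℕ.* M) ℕ.* (2 ^ suc B) ^ (k ℕ.* N))   ≡⟨ cong (2 ^ (M ℕ.* N) ℕ.*_) (cong₂ ℕ._*_ (ℕₚ.^-*-assoc 2 (suc C) (k ℕ.* M)) (ℕₚ.^-*-assoc 2 (suc B) (k ℕ.* N))) ⟩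
    2 ^ (M ℕ.* N) ℕ.* (2 ^ (suc C ℕ.* (k ℕ.* M)) ℕ.* 2 ^ (suc B ℕ.* (k ℕ.* N)))   ≡⟨ cong (2 ^ (M ℕ.* N) ℕ.*_) (ℕₚ.^-distribˡ-+-* 2 (suc C ℕ.* (k ℕ.* M)) (suc B ℕ.* (k ℕ.* N))) ⟨
    2 ^ (M ℕ.* N) ℕ.* 2 ^ (suc C ℕ.* (k ℕ.* M) ℕ.+ suc B ℕ.* (k ℕ.* N))           ≡⟨ ℕₚ.^-distribˡ-+-* 2 (M ℕ.* N) _ ⟨
    2 ^ (M ℕ.* N ℕ.+ (suc C ℕ.* (k ℕ.* M) ℕ.+ suc B ℕ.* (k ℕ.* N)))               ∎)
  where
  open ℕₚ.≤-Reasoning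
  A = ⌊log₂ a ^ M ⌋
  B = ⌊log₂ b ^ M ⌋
  C = ⌊log₂ c ^ N ⌋
  D = ⌊log₂ d ^ N ⌋
  e₁ : ∀ k M N → M ℕ.* (k ℕ.* N) ≡ k ℕ.* (M ℕ.* N)
  e₁ = ℕ-solve
  e₂ : ∀ k M N → N ℕ.* (k ℕ.* M) ≡ k ℕ.* (M ℕ.* N)
  e₂ = ℕ-solve
  gather : ∀ x y → (x ^ M) ^ (k ℕ.* N) ℕ.* (y ^ N) ^ (k ℕ.* M) ≡ ((x ℕ.* y) ^ k) ^ (M ℕ.* N)
  gather x y = begin-equality
    (x ^ M) ^ (k ℕ.* N) ℕ.* (y ^ N) ^ (k ℕ.* M)       ≡⟨ cong₂ ℕ._*_ (ℕₚ.^-*-assoc x M _) (ℕₚ.^-*-assoc y N _) ⟩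
    x ^ (M ℕ.* (k ℕ.* N)) ℕ.* y ^ (N ℕ.* (k ℕ.* M))   ≡⟨ cong₂ (λ i j → x ^ i ℕ.* y ^ j) (e₁ k M N) (e₂ k M N) ⟩
    x ^ (k ℕ.* (M ℕ.* N)) ℕ.* y ^ (k ℕ.* (M ℕ.* N))   ≡⟨ ^-distribʳ-* (k ℕ.* (M ℕ.* N)) x y ⟨
    (x ℕ.* y) ^ (k ℕ.* (M ℕ.* N))                     ≡⟨ ℕₚ.^-*-assoc (x ℕ.* y) k _ ⟨
    ((x ℕ.* y) ^ k) ^ (M ℕ.* N)                       ∎

ℚ-ring : ACR.AlmostCommutativeRing _ _
ℚ-ring = ACR.fromCommutativeRing ℚₚ.+-*-commutativeRing (λ p → dec⇒maybe (0ℚ ℚₚ.≟ p))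

p≤q⇒0≤q-p : ∀ {p q} → p ℚ.≤ q → 0ℚ ℚ.≤ q ℚ.- p
p≤q⇒0≤q-p {p} {q} h = subst (ℚ._≤ q ℚ.- p) (ℚₚ.+-inverseʳ p) (ℚₚ.+-monoˡ-≤ (ℚ.- p) h)

p+d≡q⇒p≤q : ∀ {p q d} → 0ℚ ℚ.≤ d → p ℚ.+ d ≡ q → p ℚ.≤ q
p+d≡q⇒p≤q {p} 0≤d refl = subst (ℚ._≤ p ℚ.+ _) (ℚₚ.+-identityʳ p) (ℚₚ.+-monoʳ-≤ p 0≤d)

0≤p+q : ∀ {p q} → 0ℚ ℚ.≤ p → 0ℚ ℚ.≤ q → 0ℚ ℚ.≤ p ℚ.+ q
0≤p+q = ℚₚ.+-mono-≤

0≤p*q : ∀ {p q} → 0ℚ ℚ.≤ p → 0ℚ ℚ.≤ q → 0ℚ ℚ.≤ p ℚ.* q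
0≤p*q {p} {q} hp hq = ℚₚ.nonNegative⁻¹ _ {{ℚₚ.nonNeg*nonNeg⇒nonNeg p {{ℚ.nonNegative hp}} q {{ℚ.nonNegative hq}}}}

0<p*q : ∀ {p q} → 0ℚ ℚ.< p → 0ℚ ℚ.< q → 0ℚ ℚ.< p ℚ.* q
0<p*q {p} {q} hp hq = ℚₚ.positive⁻¹ _ {{ℚₚ.pos*pos⇒pos p {{ℚ.positive hp}} q {{ℚ.positive hq}}}}

0<1 : 0ℚ ℚ.< 1ℚ
0<1 = ℚₚ.positive⁻¹ 1ℚ

0<½ : 0ℚ ℚ.< ½
0<½ = ℚₚ.positive⁻¹ ½

½*p+½*p≡p : ∀ p → ½ ℚ.* p ℚ.+ ½ ℚ.* p ≡ p
½*p+½*p≡p p = ≡.trans (≡.sym (ℚₚ.*-distribʳ-+ p ½ ½)) (ℚₚ.*-identityˡ p)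

p≤∣p∣ : ∀ p → p ℚ.≤ ℚ.∣ p ∣
p≤∣p∣ p with ℚₚ.≤-total 0ℚ p
... | inj₁ 0≤p = ℚₚ.≤-reflexive (≡.sym (ℚₚ.0≤p⇒∣p∣≡p 0≤p))
... | inj₂ p≤0 = ℚₚ.≤-trans p≤0 (ℚₚ.0≤∣p∣ p)

∣p∣≤ : ∀ {p ε} → p ℚ.≤ ε → ℚ.- p ℚ.≤ ε → ℚ.∣ p ∣ ℚ.≤ ε
∣p∣≤ {p} h₁ h₂ with ℚₚ.∣p∣≡p∨∣p∣≡-p p
... | inj₁ eq rewrite eq = h₁
... | inj₂ eq rewrite eq = h₂

∣p-q∣≡∣q-p∣ : ∀ p q → ℚ.∣ p ℚ.- q ∣ ≡ ℚ.∣ q ℚ.- p ∣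
∣p-q∣≡∣q-p∣ p q = ≡.trans (≡.sym (ℚₚ.∣-p∣≡∣p∣ (p ℚ.- q))) (cong ℚ.∣_∣ (eq p q))
  where
  eq : ∀ p q → ℚ.- (p ℚ.- q) ≡ q ℚ.- p
  eq = ring-solve ℚ-ring

∣p-q∣≤ε⇒p≤q+ε : ∀ {p q ε} → ℚ.∣ p ℚ.- q ∣ ℚ.≤ ε → p ℚ.≤ q ℚ.+ ε
∣p-q∣≤ε⇒p≤q+ε {p} {q} {ε} h = p+d≡q⇒p≤q (p≤q⇒0≤q-p (ℚₚ.≤-trans (p≤∣p∣ (p ℚ.- q)) h)) (eq p q ε)
  where
  eq : ∀ p q ε → p ℚ.+ (ε ℚ.- (p ℚ.- q)) ≡ q ℚ.+ ε
  eq = ring-solve ℚ-ring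

p≤q+ε⇒∣p-q∣≤ε : ∀ {p q ε} → p ℚ.≤ q ℚ.+ ε → q ℚ.≤ p ℚ.+ ε → ℚ.∣ p ℚ.- q ∣ ℚ.≤ ε
p≤q+ε⇒∣p-q∣≤ε {p} {q} {ε} h₁ h₂ = ∣p∣≤
    (p+d≡q⇒p≤q (p≤q⇒0≤q-p h₁) (e₁ p q ε)) (p+d≡q⇒p≤q (p≤q⇒0≤q-p h₂) (e₂ p q ε))
  where
  e₁ : ∀ p q ε → p ℚ.- q ℚ.+ (q ℚ.+ ε ℚ.- p) ≡ ε
  e₁ = ring-solve ℚ-ring
  e₂ : ∀ p q ε → ℚ.- (p ℚ.- q) ℚ.+ (p ℚ.+ ε ℚ.- q) ≡ ε
  e₂ = ring-solve ℚ-ring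

quotient : ∀ {B ε} → 0ℚ ℚ.< B → 0ℚ ℚ.< ε → ∃[ δ ] 0ℚ ℚ.< δ × B ℚ.* δ ≡ ε
quotient {B} {ε} 0<B 0<ε = ε ℚ.* ℚ.1/ B , 0<p*q 0<ε (ℚₚ.positive⁻¹ _ {{ℚₚ.1/pos⇒pos B}}) , (begin
    B ℚ.* (ε ℚ.* ℚ.1/ B)   ≡⟨ eq B ε (ℚ.1/ B) ⟩
    ε ℚ.* (B ℚ.* ℚ.1/ B)   ≡⟨ cong (ε ℚ.*_) (ℚₚ.*-inverseʳ B) ⟩
    ε ℚ.* 1ℚ               ≡⟨ ℚₚ.*-identityʳ ε ⟩
    ε                      ∎)
  where
  open ≡.≡-Reasoning
  instance
    B-pos : ℚ.Positive B
    B-pos = ℚ.positive 0<B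
    B-nonZero : ℚ.NonZero B
    B-nonZero = ℚₚ.pos⇒nonZero B
  eq : ∀ B ε i → B ℚ.* (ε ℚ.* i) ≡ ε ℚ.* (B ℚ.* i)
  eq = ring-solve ℚ-ring

1/1+ : ℕ → ℚ
1/1+ k = + 1 ℚ./ suc k

toℚᵘ-/ : ∀ i n → ℚ.toℚᵘ (i ℚ./ suc n) ℚᵘ.≃ mkℚᵘ i n
toℚᵘ-/ i n = ℚₚ.toℚᵘ-fromℚᵘ (mkℚᵘ i n)

0<1/1+ : ∀ k → 0ℚ ℚ.< 1/1+ k
0<1/1+ k = ℚₚ.positive⁻¹ (1/1+ k) {{ℚₚ.normalize-pos 1 (suc k)}}

archimedean : ∀ {ε} → 0ℚ ℚ.< ε → ∃[ k ] 1/1+ k ℚ.≤ ε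
archimedean {mkℚ (+ 0) d c}      (ℚ.*<* (ℤ.+<+ ()))
archimedean {mkℚ -[1+ n ] d c}   (ℚ.*<* ())
archimedean {mkℚ (+ suc n) d c}  _ = d , ℚₚ.toℚᵘ-cancel-≤ (begin
    ℚ.toℚᵘ (1/1+ d)   ≃⟨ toℚᵘ-/ (+ 1) d ⟩
    mkℚᵘ (+ 1) d      ≤⟨ ℚᵘ.*≤* (ℤₚ.*-monoʳ-≤-nonNeg (+ suc d) {+ 1} {+ suc n} (ℤ.+≤+ (ℕ.s≤s ℕ.z≤n))) ⟩
    mkℚᵘ (+ suc n) d  ∎)
  where open ℚᵘₚ.≤-Reasoning

1/1+-antimono : ∀ {m n} → m ℕ.≤ n → 1/1+ n ℚ.≤ 1/1+ m
1/1+-antimono {m} {n} m≤n = ℚₚ.toℚᵘ-cancel-≤ (begin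
    ℚ.toℚᵘ (1/1+ n)   ≃⟨ toℚᵘ-/ (+ 1) n ⟩
    mkℚᵘ (+ 1) n      ≤⟨ ℚᵘ.*≤* (ℤₚ.*-monoˡ-≤-nonNeg (+ 1) (ℤ.+≤+ (ℕ.s≤s m≤n))) ⟩
    mkℚᵘ (+ 1) m      ≃⟨ toℚᵘ-/ (+ 1) m ⟨
    ℚ.toℚᵘ (1/1+ m)   ∎)
  where open ℚᵘₚ.≤-Reasoning

-- For a positive rational q = a / b, since 2 ^ ⌊log₂ k⌋ ≤ k < 2 ^ (1 + ⌊log₂ k⌋),
-- the integer ⌊log₂ aⁿ⁺¹⌋ - ⌊log₂ bⁿ⁺¹⌋ differs from (n + 1) · log₂ q by at most 1,
-- so log₂≈ q n lies within 1 / (n + 1) of the base-2 logarithm of q.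
-- The value at q ≤ 0 is irrelevant.
log₂≈ : ℚ → ℕ → ℚ
log₂≈ q n = (+ ⌊log₂ ℤ.∣ ↥ q ∣ ^ suc n ⌋ ℤ.- + ⌊log₂ ↧ₙ q ^ suc n ⌋) ℚ./ suc n

log₂≈-compare : ∀ {q r} → 0ℚ ℚ.< q → 0ℚ ℚ.< r → ∀ k v → suc v ≡ suc k ℕ.+ suc k →
                q ℚ.≤ r ℚ.+ 1/1+ v ℚ.* q → ∀ m n →
                log₂≈ q m ℚ.≤ log₂≈ r n ℚ.+ (1/1+ k ℚ.+ (1/1+ m ℚ.+ 1/1+ n))
log₂≈-compare {mkℚ (+ 0) _ _}     (ℚ.*<* (ℤ.+<+ ()))
log₂≈-compare {mkℚ -[1+ _ ] _ _}  (ℚ.*<* ())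
log₂≈-compare {mkℚ (+ suc _) _ _} {mkℚ (+ 0) _ _}     _ (ℚ.*<* (ℤ.+<+ ()))
log₂≈-compare {mkℚ (+ suc _) _ _} {mkℚ -[1+ _ ] _ _}  _ (ℚ.*<* ())
log₂≈-compare {q@(mkℚ (+ suc a₁) b₁ cq)} {r@(mkℚ (+ suc c₁) d₁ cr)} _ _ k₁ v eqv h m₁ n₁ =
    ℚₚ.toℚᵘ-cancel-≤ (begin
      ℚ.toℚᵘ (log₂≈ q m₁)        ≃⟨ toℚᵘ-/ (+ A ℤ.- + B) m₁ ⟩
      mkℚᵘ (+ A ℤ.- + B) m₁      ≤⟨ ℚᵘ.*≤* (subst₂ ℤ._≤_ (i₁ (+ A) (+ B) (+ k) (+ M) (+ N)) (i₂ (+ C) (+ D) (+ k) (+ M) (+ N)) (ℤₚ.*-monoʳ-≤-nonNeg (+ (M ℕ.* N)) key)) ⟩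
      mkℚᵘ (+ C ℤ.- + D) n₁ ℚᵘ.+ (mkℚᵘ (+ 1) k₁ ℚᵘ.+ (mkℚᵘ (+ 1) m₁ ℚᵘ.+ mkℚᵘ (+ 1) n₁))
         ≃⟨ ℚᵘₚ.+-cong (toℚᵘ-/ (+ C ℤ.- + D) n₁) (ℚᵘₚ.+-cong (toℚᵘ-/ (+ 1) k₁) (ℚᵘₚ.+-cong (toℚᵘ-/ (+ 1) m₁) (toℚᵘ-/ (+ 1) n₁))) ⟨
      ℚ.toℚᵘ (log₂≈ r n₁) ℚᵘ.+ (ℚ.toℚᵘ (1/1+ k₁) ℚᵘ.+ (ℚ.toℚᵘ (1/1+ m₁) ℚᵘ.+ ℚ.toℚᵘ (1/1+ n₁)))
         ≃⟨ ℚᵘₚ.+-congʳ (ℚ.toℚᵘ (log₂≈ r n₁)) (ℚᵘₚ.≃-trans (ℚₚ.toℚᵘ-homo-+ (1/1+ k₁) (1/1+ m₁ ℚ.+ 1/1+ n₁)) (ℚᵘₚ.+-congʳ (ℚ.toℚᵘ (1/1+ k₁)) (ℚₚ.toℚᵘ-homo-+ (1/1+ m₁) (1/1+ n₁)))) ⟨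
      ℚ.toℚᵘ (log₂≈ r n₁) ℚᵘ.+ ℚ.toℚᵘ (1/1+ k₁ ℚ.+ (1/1+ m₁ ℚ.+ 1/1+ n₁))
         ≃⟨ ℚₚ.toℚᵘ-homo-+ (log₂≈ r n₁) _ ⟨
      ℚ.toℚᵘ (log₂≈ r n₁ ℚ.+ (1/1+ k₁ ℚ.+ (1/1+ m₁ ℚ.+ 1/1+ n₁))) ∎)
  where
  open ℚᵘₚ.≤-Reasoning
  a = suc a₁
  b = suc b₁
  c = suc c₁
  d = suc d₁
  k = suc k₁
  M = suc m₁
  N = suc n₁
  T = suc v
  A = ⌊log₂ a ^ M ⌋
  B = ⌊log₂ b ^ M ⌋
  C = ⌊log₂ c ^ N ⌋
  D = ⌊log₂ d ^ N ⌋

  hᵘ : mkℚᵘ (+ a) b₁ ℚᵘ.≤ mkℚᵘ (+ c) d₁ ℚᵘ.+ mkℚᵘ (+ 1) v ℚᵘ.* mkℚᵘ (+ a) b₁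
  hᵘ = ℚᵘₚ.≤-respʳ-≃ (ℚᵘₚ.≃-trans (ℚₚ.toℚᵘ-homo-+ r (1/1+ v ℚ.* q))
        (ℚᵘₚ.+-congʳ (ℚ.toℚᵘ r) (ℚᵘₚ.≃-trans (ℚₚ.toℚᵘ-homo-* (1/1+ v) q) (ℚᵘₚ.*-congʳ {ℚ.toℚᵘ q} (toℚᵘ-/ (+ 1) v)))))
        (ℚₚ.toℚᵘ-mono-≤ h)

  hℕ : a ℕ.* (d ℕ.* (T ℕ.* b)) ℕ.≤ (c ℕ.* (T ℕ.* b) ℕ.+ 1 ℕ.* a ℕ.* d) ℕ.* b
  hℕ = ℤₚ.drop‿+≤+ (ℚᵘₚ.drop-*≤* hᵘ)

  n₁′ : ∀ a b d v → a ℕ.* (d ℕ.* (suc v ℕ.* b)) ≡ (a ℕ.* d ℕ.* v ℕ.+ a ℕ.* d) ℕ.* b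
  n₁′ = ℕ-solve
  n₂′ : ∀ a b c d T → (c ℕ.* (T ℕ.* b) ℕ.+ 1 ℕ.* a ℕ.* d) ℕ.* b ≡ (c ℕ.* b ℕ.* T ℕ.+ a ℕ.* d) ℕ.* b
  n₂′ = ℕ-solve

  scaled : a ℕ.* d ℕ.* v ℕ.≤ c ℕ.* b ℕ.* T
  scaled = ℕₚ.+-cancelʳ-≤ (a ℕ.* d) _ _
             (ℕₚ.*-cancelʳ-≤ (a ℕ.* d ℕ.* v ℕ.+ a ℕ.* d) (c ℕ.* b ℕ.* T ℕ.+ a ℕ.* d) b
                (subst₂ ℕ._≤_ (n₁′ a b d v) (n₂′ a b c d T) hℕ))

  instance
    v-nonZero : ℕ.NonZero v
    v-nonZero = subst ℕ.NonZero (≡.trans (≡.sym (ℕₚ.+-suc k₁ k₁)) (≡.sym (ℕₚ.suc-injective eqv))) _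

  power : (a ℕ.* d) ^ k ℕ.≤ 2 ℕ.* (c ℕ.* b) ^ k
  power = ℕₚ.*-cancelʳ-≤ ((a ℕ.* d) ^ k) (2 ℕ.* (c ℕ.* b) ^ k) (v ^ k) {{ℕₚ.m^n≢0 v k}} (R.begin
    (a ℕ.* d) ^ k ℕ.* v ^ k            R.≡⟨ ^-distribʳ-* k (a ℕ.* d) v ⟨
    (a ℕ.* d ℕ.* v) ^ k                R.≤⟨ ℕₚ.^-monoˡ-≤ k scaled ⟩
    (c ℕ.* b ℕ.* T) ^ k                R.≡⟨ ^-distribʳ-* k (c ℕ.* b) T ⟩
    (c ℕ.* b) ^ k ℕ.* T ^ k            R.≤⟨ ℕₚ.*-monoʳ-≤ ((c ℕ.* b) ^ k) (half-power k v eqv) ⟩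
    (c ℕ.* b) ^ k ℕ.* (2 ℕ.* v ^ k)    R.≡⟨ n₃ ((c ℕ.* b) ^ k) (v ^ k) ⟩
    2 ℕ.* (c ℕ.* b) ^ k ℕ.* v ^ k      R.∎)
    where
    module R = ℕₚ.≤-Reasoning
    n₃ : ∀ x y → x ℕ.* (2 ℕ.* y) ≡ 2 ℕ.* x ℕ.* y
    n₃ = ℕ-solve

  pos-** : ∀ x y z → + (x ℕ.* (y ℕ.* z)) ≡ + x ℤ.* (+ y ℤ.* + z)
  pos-** x y z = ≡.trans (ℤₚ.pos-* x (y ℕ.* z)) (cong (+ x ℤ.*_) (ℤₚ.pos-* y z))

  keyℤ : + A ℤ.* (+ k ℤ.* + N) ℤ.+ + D ℤ.* (+ k ℤ.* + M) ℤ.≤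
         + M ℤ.* + N ℤ.+ ((+ 1 ℤ.+ + C) ℤ.* (+ k ℤ.* + M) ℤ.+ (+ 1 ℤ.+ + B) ℤ.* (+ k ℤ.* + N))
  keyℤ = subst₂ ℤ._≤_
    (cong₂ ℤ._+_ (pos-** A k N) (pos-** D k M))
    (cong₂ ℤ._+_ (ℤₚ.pos-* M N) (cong₂ ℤ._+_ (pos-** (suc C) k M) (pos-** (suc B) k N)))
    (ℤ.+≤+ (⌊log₂⌋-compare a b c d k M N power))

  key : (+ A ℤ.- + B) ℤ.* (+ k ℤ.* + N) ℤ.≤ + M ℤ.* + N ℤ.+ ((+ C ℤ.- + D) ℤ.* (+ k ℤ.* + M) ℤ.+ (+ k ℤ.* + M ℤ.+ + k ℤ.* + N))
  key = subst₂ ℤ._≤_ (i₃ (+ A) (+ B) (+ D) (+ k) (+ M) (+ N)) (i₄ (+ B) (+ C) (+ D) (+ k) (+ M) (+ N))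
    (ℤₚ.+-monoˡ-≤ (ℤ.- (+ B ℤ.* (+ k ℤ.* + N) ℤ.+ + D ℤ.* (+ k ℤ.* + M))) keyℤ)
    where
    i₃ : ∀ A B D k M N → A ℤ.* (k ℤ.* N) ℤ.+ D ℤ.* (k ℤ.* M) ℤ.+ ℤ.- (B ℤ.* (k ℤ.* N) ℤ.+ D ℤ.* (k ℤ.* M)) ≡ (A ℤ.- B) ℤ.* (k ℤ.* N)
    i₃ = ℤ-solve
    i₄ : ∀ B C D k M N → M ℤ.* N ℤ.+ ((+ 1 ℤ.+ C) ℤ.* (k ℤ.* M) ℤ.+ (+ 1 ℤ.+ B) ℤ.* (k ℤ.* N)) ℤ.+ ℤ.- (B ℤ.* (k ℤ.* N) ℤ.+ D ℤ.* (k ℤ.* M)) ≡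
         M ℤ.* N ℤ.+ ((C ℤ.- D) ℤ.* (k ℤ.* M) ℤ.+ (k ℤ.* M ℤ.+ k ℤ.* N))
    i₄ = ℤ-solve

  i₁ : ∀ A B k M N → (A ℤ.- B) ℤ.* (k ℤ.* N) ℤ.* (M ℤ.* N) ≡ (A ℤ.- B) ℤ.* (N ℤ.* (k ℤ.* (M ℤ.* N)))
  i₁ = ℤ-solve
  i₂ : ∀ C D k M N → (M ℤ.* N ℤ.+ ((C ℤ.- D) ℤ.* (k ℤ.* M) ℤ.+ (k ℤ.* M ℤ.+ k ℤ.* N))) ℤ.* (M ℤ.* N) ≡
       ((C ℤ.- D) ℤ.* (k ℤ.* (M ℤ.* N)) ℤ.+ (+ 1 ℤ.* (M ℤ.* N) ℤ.+ (+ 1 ℤ.* N ℤ.+ + 1 ℤ.* M) ℤ.* k) ℤ.* N) ℤ.* M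
  i₂ = ℤ-solve

IsCauchy : (ℕ → ℚ) → Set
IsCauchy x = ∀ ε → 0ℚ ℚ.< ε → ∃[ N ] (∀ m n → N ℕ.≤ m → N ℕ.≤ n → ℚ.∣ x m ℚ.- x n ∣ ℚ.≤ ε)

-- Real numbers as Cauchy sequences of rationals with a modulus of convergence;
-- equality of reals is _≈_ below.
record ℝ : Set where
  no-eta-equality
  field
    seq    : ℕ → ℚ
    cauchy : IsCauchy seq

open ℝ public

Eventually : (ℕ → Set) → Set
Eventually P = ∃[ N ] (∀ n → N ℕ.≤ n → P n)

always : ∀ {P : ℕ → Set} → (∀ n → P n) → Eventually P
always p = 0 , λ n _ → p n

mapᵉ : ∀ {P Q : ℕ → Set} → Eventually P → (∀ n → P n → Q n) → Eventually Q
mapᵉ (N , p) f = N , λ n N≤n → f n (p n N≤n)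

zipᵉ : ∀ {P Q R : ℕ → Set} → Eventually P → Eventually Q → (∀ n → P n → Q n → R n) → Eventually R
zipᵉ (M , p) (N , q) f = M ℕ.⊔ N , λ n h →
  f n (p n (ℕₚ.≤-trans (ℕₚ.m≤m⊔n M N) h)) (q n (ℕₚ.≤-trans (ℕₚ.m≤n⊔m M N) h))

bothᵉ : ∀ {P Q : ℕ → Set} → Eventually P → Eventually Q → Eventually (λ n → P n × Q n)
bothᵉ p q = zipᵉ p q (λ _ → _,_)

infix 4 _≤_ _<_ _≈_ _#_

record _≤_ (x y : ℝ) : Set where
  constructor mk≤
  field
    eventually-≤ : ∀ ε → 0ℚ ℚ.< ε → Eventually (λ n → seq x n ℚ.≤ seq y n ℚ.+ ε)

record _<_ (x y : ℝ) : Set where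
  constructor mk<
  field
    margin     : ℚ
    0<margin   : 0ℚ ℚ.< margin
    separated  : Eventually (λ n → seq x n ℚ.+ margin ℚ.≤ seq y n)

record _≈_ (x y : ℝ) : Set where
  constructor mk≈
  field
    ≈⇒≤ : x ≤ y
    ≈⇒≥ : y ≤ x

open _≤_ public
open _<_ public
open _≈_ public

-- Apartness, the constructive reading of ≠ between reals; classically the same.
_#_ : ℝ → ℝ → Set
x # y = x < y ⊎ y < x

cauchy-intro : ∀ x → (∀ ε → 0ℚ ℚ.< ε → ∃[ N ] (∀ m n → N ℕ.≤ m → N ℕ.≤ n → x m ℚ.≤ x n ℚ.+ ε)) → IsCauchy x
cauchy-intro x h ε 0<ε with h ε 0<ε
... | N , p = N , λ m n hm hn → p≤q+ε⇒∣p-q∣≤ε (p m n hm hn) (p n m hn hm)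

cauchy-elim : ∀ (x : ℝ) ε → 0ℚ ℚ.< ε → ∃[ N ] (∀ m n → N ℕ.≤ m → N ℕ.≤ n → seq x m ℚ.≤ seq x n ℚ.+ ε)
cauchy-elim x ε 0<ε with cauchy x ε 0<ε
... | N , p = N , λ m n hm hn → ∣p-q∣≤ε⇒p≤q+ε (p m n hm hn)

half : ∀ {ε} → 0ℚ ℚ.< ε → 0ℚ ℚ.< ½ ℚ.* ε
half = 0<p*q 0<½

combine₂ : ∀ {P Q R : ℕ → ℕ → Set} → (∀ m n → P m n → Q m n → R m n) →
           ∃[ N ] (∀ m n → N ℕ.≤ m → N ℕ.≤ n → P m n) →
           ∃[ N ] (∀ m n → N ℕ.≤ m → N ℕ.≤ n → Q m n) →
           ∃[ N ] (∀ m n → N ℕ.≤ m → N ℕ.≤ n → R m n)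
combine₂ f (M , p) (N , q) = M ℕ.⊔ N , λ m n hm hn → f m n
  (p m n (ℕₚ.≤-trans (ℕₚ.m≤m⊔n M N) hm) (ℕₚ.≤-trans (ℕₚ.m≤m⊔n M N) hn))
  (q m n (ℕₚ.≤-trans (ℕₚ.m≤n⊔m M N) hm) (ℕₚ.≤-trans (ℕₚ.m≤n⊔m M N) hn))

eventually-bounded : (x : ℝ) → ∃[ B ] 0ℚ ℚ.< B × Eventually (λ n → ℚ.∣ seq x n ∣ ℚ.≤ B)
eventually-bounded x with cauchy x 1ℚ 0<1
... | N , p = ℚ.∣ seq x N ∣ ℚ.+ 1ℚ ,
    ℚₚ.<-≤-trans 0<1 (p+d≡q⇒p≤q (ℚₚ.0≤∣p∣ (seq x N)) (ℚₚ.+-comm 1ℚ ℚ.∣ seq x N ∣)) ,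
    N , λ n h → begin
      ℚ.∣ seq x n ∣                                      ≡⟨ cong ℚ.∣_∣ (eq (seq x n) (seq x N)) ⟩
      ℚ.∣ seq x N ℚ.+ (seq x n ℚ.- seq x N) ∣            ≤⟨ ℚₚ.∣p+q∣≤∣p∣+∣q∣ (seq x N) _ ⟩
      ℚ.∣ seq x N ∣ ℚ.+ ℚ.∣ seq x n ℚ.- seq x N ∣        ≤⟨ ℚₚ.+-monoʳ-≤ ℚ.∣ seq x N ∣ (p n N h ℕₚ.≤-refl) ⟩
      ℚ.∣ seq x N ∣ ℚ.+ 1ℚ                               ∎
  where
  open ℚₚ.≤-Reasoning
  eq : ∀ p q → p ≡ q ℚ.+ (p ℚ.- q)
  eq = ring-solve ℚ-ring

infix  8 -_
infixl 7 _*_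
infixl 6 _+_ _-_ _⊔_

fromℚ : ℚ → ℝ
seq    (fromℚ q) _ = q
cauchy (fromℚ q) = cauchy-intro (λ _ → q) λ ε 0<ε → 0 , λ _ _ _ _ →
  p+d≡q⇒p≤q (ℚₚ.<⇒≤ 0<ε) refl

0ℝ 1ℝ : ℝ
0ℝ = fromℚ 0ℚ
1ℝ = fromℚ 1ℚ

+-ε : ∀ p q {ε} → p ℚ.+ ½ ℚ.* ε ℚ.+ (q ℚ.+ ½ ℚ.* ε) ≡ p ℚ.+ q ℚ.+ ε
+-ε p q {ε} = ≡.trans (eq p q (½ ℚ.* ε)) (cong (p ℚ.+ q ℚ.+_) (½*p+½*p≡p ε))
  where
  eq : ∀ p q δ → p ℚ.+ δ ℚ.+ (q ℚ.+ δ) ≡ p ℚ.+ q ℚ.+ (δ ℚ.+ δ)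
  eq = ring-solve ℚ-ring

_+_ : ℝ → ℝ → ℝ
seq    (x + y) n = seq x n ℚ.+ seq y n
cauchy (x + y) = (cauchy-intro (λ n → seq x n ℚ.+ seq y n) λ ε 0<ε →
  combine₂ (λ m n p q → ℚₚ.≤-trans (ℚₚ.+-mono-≤ p q) (ℚₚ.≤-reflexive (+-ε (seq x n) (seq y n))))
    (cauchy-elim x (½ ℚ.* ε) (half 0<ε)) (cauchy-elim y (½ ℚ.* ε) (half 0<ε)))

-_ : ℝ → ℝ
seq    (- x) n = ℚ.- seq x n
cauchy (- x) = (cauchy-intro (λ n → ℚ.- seq x n) λ ε 0<ε →
  let N , p = cauchy-elim x ε 0<ε in
  N , λ m n hm hn → p+d≡q⇒p≤q (p≤q⇒0≤q-p (p n m hn hm)) (eq (seq x n) (seq x m) ε))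
  where
  eq : ∀ p q ε → ℚ.- q ℚ.+ (q ℚ.+ ε ℚ.- p) ≡ ℚ.- p ℚ.+ ε
  eq = ring-solve ℚ-ring

_-_ : ℝ → ℝ → ℝ
x - y = x + (- y)

_⊔_ : ℝ → ℝ → ℝ
seq    (x ⊔ y) n = seq x n ℚ.⊔ seq y n
cauchy (x ⊔ y) = (cauchy-intro (λ n → seq x n ℚ.⊔ seq y n) λ ε 0<ε →
  combine₂ (λ m n p q → ℚₚ.⊔-lub
      (ℚₚ.≤-trans p (ℚₚ.+-monoˡ-≤ ε (ℚₚ.p≤p⊔q (seq x n) (seq y n))))
      (ℚₚ.≤-trans q (ℚₚ.+-monoˡ-≤ ε (ℚₚ.p≤q⊔p (seq x n) (seq y n)))))
    (cauchy-elim x ε 0<ε) (cauchy-elim y ε 0<ε))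

*-bound : ∀ {p q B δ} → ℚ.∣ p ∣ ℚ.≤ δ → ℚ.∣ q ∣ ℚ.≤ B → ℚ.∣ p ℚ.* q ∣ ℚ.≤ B ℚ.* δ
*-bound {p} {q} {B} {δ} hp hq = begin
  ℚ.∣ p ℚ.* q ∣              ≡⟨ ℚₚ.∣p*q∣≡∣p∣*∣q∣ p q ⟩
  ℚ.∣ p ∣ ℚ.* ℚ.∣ q ∣        ≤⟨ ℚₚ.*-monoˡ-≤-nonNeg ℚ.∣ p ∣ {{ℚₚ.∣-∣-nonNeg p}} hq ⟩
  ℚ.∣ p ∣ ℚ.* B              ≤⟨ ℚₚ.*-monoʳ-≤-nonNeg B {{ℚ.nonNegative (ℚₚ.≤-trans (ℚₚ.0≤∣p∣ q) hq)}} hp ⟩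
  δ ℚ.* B                    ≡⟨ ℚₚ.*-comm δ B ⟩
  B ℚ.* δ                    ∎
  where open ℚₚ.≤-Reasoning

*-close : ∀ p p′ q q′ {B C δ₁ δ₂} → ℚ.∣ p ℚ.- p′ ∣ ℚ.≤ δ₁ → ℚ.∣ q ℚ.- q′ ∣ ℚ.≤ δ₂ →
          ℚ.∣ p ∣ ℚ.≤ B → ℚ.∣ q′ ∣ ℚ.≤ C → p ℚ.* q ℚ.≤ p′ ℚ.* q′ ℚ.+ (C ℚ.* δ₁ ℚ.+ B ℚ.* δ₂)
*-close p p′ q q′ {B} {C} {δ₁} {δ₂} h₁ h₂ hB hC = begin
  p ℚ.* q                                                             ≡⟨ eq p p′ q q′ ⟩
  p′ ℚ.* q′ ℚ.+ ((p ℚ.- p′) ℚ.* q′ ℚ.+ (q ℚ.- q′) ℚ.* p)             ≤⟨ ℚₚ.+-monoʳ-≤ (p′ ℚ.* q′) (ℚₚ.+-mono-≤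
                                                                          (ℚₚ.≤-trans (p≤∣p∣ _) (*-bound {p ℚ.- p′} {q′} h₁ hC))
                                                                          (ℚₚ.≤-trans (p≤∣p∣ _) (*-bound {q ℚ.- q′} {p} h₂ hB))) ⟩
  p′ ℚ.* q′ ℚ.+ (C ℚ.* δ₁ ℚ.+ B ℚ.* δ₂)                               ∎
  where
  open ℚₚ.≤-Reasoning
  eq : ∀ p p′ q q′ → p ℚ.* q ≡ p′ ℚ.* q′ ℚ.+ ((p ℚ.- p′) ℚ.* q′ ℚ.+ (q ℚ.- q′) ℚ.* p)
  eq = ring-solve ℚ-ring

*-close′ : ∀ p p′ q q′ {B C δ₁ δ₂ ε} → C ℚ.* δ₁ ≡ ½ ℚ.* ε → B ℚ.* δ₂ ≡ ½ ℚ.* ε →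
           ℚ.∣ p ℚ.- p′ ∣ ℚ.≤ δ₁ → ℚ.∣ q ℚ.- q′ ∣ ℚ.≤ δ₂ →
           ℚ.∣ p ∣ ℚ.≤ B → ℚ.∣ q′ ∣ ℚ.≤ C → p ℚ.* q ℚ.≤ p′ ℚ.* q′ ℚ.+ ε
*-close′ p p′ q q′ {B} {C} {δ₁} {δ₂} {ε} e₁ e₂ h₁ h₂ hB hC = ℚₚ.≤-trans
  (*-close p p′ q q′ {B} {C} {δ₁} {δ₂} h₁ h₂ hB hC)
  (ℚₚ.≤-reflexive (cong (p′ ℚ.* q′ ℚ.+_) (≡.trans (cong₂ ℚ._+_ e₁ e₂) (½*p+½*p≡p ε))))

_*_ : ℝ → ℝ → ℝ
seq    (x * y) n = seq x n ℚ.* seq y n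
cauchy (x * y) = (cauchy-intro (λ n → seq x n ℚ.* seq y n) is-cauchy)
  where
  is-cauchy : ∀ ε → 0ℚ ℚ.< ε → ∃[ N ] (∀ m n → N ℕ.≤ m → N ℕ.≤ n →
              seq x m ℚ.* seq y m ℚ.≤ seq x n ℚ.* seq y n ℚ.+ ε)
  is-cauchy ε 0<ε =
    let B , 0<B , N₁ , hB  = eventually-bounded x
        C , 0<C , N₂ , hC  = eventually-bounded y
        δ₁ , 0<δ₁ , eq₁    = quotient {C} {½ ℚ.* ε} 0<C (half 0<ε)
        δ₂ , 0<δ₂ , eq₂    = quotient {B} {½ ℚ.* ε} 0<B (half 0<ε)
        N₃ , hx            = cauchy x δ₁ 0<δ₁
        N₄ , hy            = cauchy y δ₂ 0<δ₂
    in (N₁ ℕ.⊔ N₂) ℕ.⊔ (N₃ ℕ.⊔ N₄) , λ m n hm hn →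
      let le₁ = ℕₚ.≤-trans (ℕₚ.m≤m⊔n N₁ N₂) (ℕₚ.m≤m⊔n (N₁ ℕ.⊔ N₂) (N₃ ℕ.⊔ N₄))
          le₂ = ℕₚ.≤-trans (ℕₚ.m≤n⊔m N₁ N₂) (ℕₚ.m≤m⊔n (N₁ ℕ.⊔ N₂) (N₃ ℕ.⊔ N₄))
          le₃ = ℕₚ.≤-trans (ℕₚ.m≤m⊔n N₃ N₄) (ℕₚ.m≤n⊔m (N₁ ℕ.⊔ N₂) (N₃ ℕ.⊔ N₄))
          le₄ = ℕₚ.≤-trans (ℕₚ.m≤n⊔m N₃ N₄) (ℕₚ.m≤n⊔m (N₁ ℕ.⊔ N₂) (N₃ ℕ.⊔ N₄))
      in *-close′ (seq x m) (seq x n) (seq y m) (seq y n) {B} {C} {δ₁} {δ₂} {ε} eq₁ eq₂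
           (hx m n (ℕₚ.≤-trans le₃ hm) (ℕₚ.≤-trans le₃ hn))
           (hy m n (ℕₚ.≤-trans le₄ hm) (ℕₚ.≤-trans le₄ hn))
           (hB m (ℕₚ.≤-trans le₁ hm)) (hC n (ℕₚ.≤-trans le₂ hn))

≤-refl : ∀ {x} → x ≤ x
≤-refl {x} = mk≤ λ ε 0<ε → always λ n → p+d≡q⇒p≤q {seq x n} {seq x n ℚ.+ ε} {ε} (ℚₚ.<⇒≤ 0<ε) refl

ε-trans : ∀ p q r {ε} → p ℚ.≤ q ℚ.+ ½ ℚ.* ε → q ℚ.≤ r ℚ.+ ½ ℚ.* ε → p ℚ.≤ r ℚ.+ ε
ε-trans p q r {ε} h₁ h₂ = begin
  p                                  ≤⟨ h₁ ⟩
  q ℚ.+ ½ ℚ.* ε                      ≤⟨ ℚₚ.+-monoˡ-≤ (½ ℚ.* ε) h₂ ⟩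
  r ℚ.+ ½ ℚ.* ε ℚ.+ ½ ℚ.* ε          ≡⟨ ℚₚ.+-assoc r (½ ℚ.* ε) (½ ℚ.* ε) ⟩
  r ℚ.+ (½ ℚ.* ε ℚ.+ ½ ℚ.* ε)        ≡⟨ cong (r ℚ.+_) (½*p+½*p≡p ε) ⟩
  r ℚ.+ ε                            ∎
  where open ℚₚ.≤-Reasoning

+-cancelʳ-≤ : ∀ r p q → p ℚ.+ r ℚ.≤ q ℚ.+ r → p ℚ.≤ q
+-cancelʳ-≤ r p q h = p+d≡q⇒p≤q (p≤q⇒0≤q-p h) (eq p q r)
  where
  eq : ∀ p q r → p ℚ.+ (q ℚ.+ r ℚ.- (p ℚ.+ r)) ≡ q
  eq = ring-solve ℚ-ring

≤-trans : ∀ {x y z} → x ≤ y → y ≤ z → x ≤ z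
≤-trans {x} {y} {z} (mk≤ x≤y) (mk≤ y≤z) = mk≤ λ ε 0<ε →
  zipᵉ (x≤y (½ ℚ.* ε) (half 0<ε)) (y≤z (½ ℚ.* ε) (half 0<ε)) (λ n → ε-trans (seq x n) (seq y n) (seq z n))

<-≤-trans : ∀ {x y z} → x < y → y ≤ z → x < z
<-≤-trans {x} {y} {z} (mk< ε 0<ε x<y) (mk≤ y≤z) = mk< (½ ℚ.* ε) (half 0<ε)
  (zipᵉ x<y (y≤z (½ ℚ.* ε) (half 0<ε)) (λ n → lemma (seq x n) (seq y n) (seq z n)))
  where
  lemma : ∀ p q r → p ℚ.+ ε ℚ.≤ q → q ℚ.≤ r ℚ.+ ½ ℚ.* ε → p ℚ.+ ½ ℚ.* ε ℚ.≤ r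
  lemma p q r h₁ h₂ = +-cancelʳ-≤ (½ ℚ.* ε) (p ℚ.+ ½ ℚ.* ε) r (begin
    p ℚ.+ ½ ℚ.* ε ℚ.+ ½ ℚ.* ε          ≡⟨ ℚₚ.+-assoc p (½ ℚ.* ε) (½ ℚ.* ε) ⟩
    p ℚ.+ (½ ℚ.* ε ℚ.+ ½ ℚ.* ε)        ≡⟨ cong (p ℚ.+_) (½*p+½*p≡p ε) ⟩
    p ℚ.+ ε                            ≤⟨ h₁ ⟩
    q                                  ≤⟨ h₂ ⟩
    r ℚ.+ ½ ℚ.* ε                      ∎)
    where open ℚₚ.≤-Reasoning

≤-<-trans : ∀ {x y z} → x ≤ y → y < z → x < z
≤-<-trans {x} {y} {z} (mk≤ x≤y) (mk< ε 0<ε y<z) = mk< (½ ℚ.* ε) (half 0<ε)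
  (zipᵉ (x≤y (½ ℚ.* ε) (half 0<ε)) y<z (λ n → lemma (seq x n) (seq y n) (seq z n)))
  where
  lemma : ∀ p q r → p ℚ.≤ q ℚ.+ ½ ℚ.* ε → q ℚ.+ ε ℚ.≤ r → p ℚ.+ ½ ℚ.* ε ℚ.≤ r
  lemma p q r h₁ h₂ = begin
    p ℚ.+ ½ ℚ.* ε                      ≤⟨ ℚₚ.+-monoˡ-≤ (½ ℚ.* ε) h₁ ⟩
    q ℚ.+ ½ ℚ.* ε ℚ.+ ½ ℚ.* ε          ≡⟨ ℚₚ.+-assoc q (½ ℚ.* ε) (½ ℚ.* ε) ⟩
    q ℚ.+ (½ ℚ.* ε ℚ.+ ½ ℚ.* ε)        ≡⟨ cong (q ℚ.+_) (½*p+½*p≡p ε) ⟩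
    q ℚ.+ ε                            ≤⟨ h₂ ⟩
    r                                  ∎
    where open ℚₚ.≤-Reasoning

≤⇒≯ : ∀ {x y} → x ≤ y → ¬ (y < x)
≤⇒≯ {x} {y} x≤y y<x with ≤-<-trans x≤y y<x
... | mk< ε 0<ε (N , h) = ℚₚ.<-irrefl refl (ℚₚ.<-≤-trans
        (subst (ℚ._< seq x N ℚ.+ ε) (ℚₚ.+-identityʳ (seq x N)) (ℚₚ.+-monoʳ-< (seq x N) 0<ε))
        (h N ℕₚ.≤-refl))

≈-refl : ∀ {x} → x ≈ x
≈-refl = mk≈ ≤-refl ≤-refl

≈-sym : ∀ {x y} → x ≈ y → y ≈ x
≈-sym (mk≈ p q) = mk≈ q p

≈-trans : ∀ {x y z} → x ≈ y → y ≈ z → x ≈ z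
≈-trans (mk≈ p q) (mk≈ r s) = mk≈ (≤-trans p r) (≤-trans s q)

pointwise⇒≤ : ∀ {x y} → (∀ n → seq x n ℚ.≤ seq y n) → x ≤ y
pointwise⇒≤ {x} {y} h = mk≤ λ ε 0<ε → always λ n →
  ℚₚ.≤-trans (h n) (p+d≡q⇒p≤q {seq y n} {seq y n ℚ.+ ε} {ε} (ℚₚ.<⇒≤ 0<ε) refl)

pointwise⇒≈ : ∀ {x y} → (∀ n → seq x n ≡ seq y n) → x ≈ y
pointwise⇒≈ h = mk≈ (pointwise⇒≤ λ n → ℚₚ.≤-reflexive (h n))
                    (pointwise⇒≤ λ n → ℚₚ.≤-reflexive (≡.sym (h n)))

≈⇒close : ∀ {x y} → x ≈ y → ∀ ε → 0ℚ ℚ.< ε → Eventually (λ n → ℚ.∣ seq x n ℚ.- seq y n ∣ ℚ.≤ ε)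
≈⇒close {x} {y} (mk≈ (mk≤ p) (mk≤ q)) ε 0<ε = zipᵉ (p ε 0<ε) (q ε 0<ε) (λ n → p≤q+ε⇒∣p-q∣≤ε {seq x n} {seq y n})

+-mono-≤ : ∀ {x x′ y y′} → x ≤ x′ → y ≤ y′ → x + y ≤ x′ + y′
+-mono-≤ {x} {x′} {y} {y′} (mk≤ p) (mk≤ q) = mk≤ λ ε 0<ε →
  zipᵉ (p (½ ℚ.* ε) (half 0<ε)) (q (½ ℚ.* ε) (half 0<ε)) (λ n a b →
    ℚₚ.≤-trans (ℚₚ.+-mono-≤ a b) (ℚₚ.≤-reflexive (+-ε (seq x′ n) (seq y′ n))))

-‿antimono-≤ : ∀ {x y} → x ≤ y → - y ≤ - x
-‿antimono-≤ {x} {y} (mk≤ p) = mk≤ λ ε 0<ε →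
  mapᵉ (p ε 0<ε) (λ n h → p+d≡q⇒p≤q (p≤q⇒0≤q-p h) (eq (seq x n) (seq y n) ε))
  where
  eq : ∀ p q ε → ℚ.- q ℚ.+ (q ℚ.+ ε ℚ.- p) ≡ ℚ.- p ℚ.+ ε
  eq = ring-solve ℚ-ring

*-cong-≤ : ∀ {x x′ y y′} → x ≈ x′ → y ≈ y′ → x * y ≤ x′ * y′
*-cong-≤ {x} {x′} {y} {y′} p q = mk≤ λ ε 0<ε →
  let B , 0<B , hB     = eventually-bounded x
      C , 0<C , hC     = eventually-bounded y′
      δ₁ , 0<δ₁ , eq₁  = quotient {C} {½ ℚ.* ε} 0<C (half 0<ε)
      δ₂ , 0<δ₂ , eq₂  = quotient {B} {½ ℚ.* ε} 0<B (half 0<ε)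
  in zipᵉ (bothᵉ hB hC) (bothᵉ (≈⇒close p δ₁ 0<δ₁) (≈⇒close q δ₂ 0<δ₂))
       (λ n (b , c) (h₁ , h₂) →
         *-close′ (seq x n) (seq x′ n) (seq y n) (seq y′ n) {B} {C} {δ₁} {δ₂} {ε} eq₁ eq₂ h₁ h₂ b c)

+-*-commutativeRing : CommutativeRing 0ℓ 0ℓ
+-*-commutativeRing = record
  { Carrier = ℝ
  ; _≈_ = _≈_
  ; _+_ = _+_
  ; _*_ = _*_
  ; -_  = -_
  ; 0#  = 0ℝ
  ; 1#  = 1ℝ
  ; isCommutativeRing = record
    { isRing = record
      { +-isAbelianGroup = record
        { isGroup = record
          { isMonoid = record
            { isSemigroup = record
              { isMagma = record
                { isEquivalence = record
                  { refl  = ≈-refl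
                  ; sym   = ≈-sym
                  ; trans = ≈-trans
                  }
                ; ∙-cong = λ (mk≈ p q) (mk≈ r s) → mk≈ (+-mono-≤ p r) (+-mono-≤ q s)
                }
              ; assoc = λ x y z → pointwise⇒≈ λ n → ℚₚ.+-assoc (seq x n) (seq y n) (seq z n)
              }
            ; identity = (λ x → pointwise⇒≈ λ n → ℚₚ.+-identityˡ (seq x n)) ,
                         (λ x → pointwise⇒≈ λ n → ℚₚ.+-identityʳ (seq x n))
            }
          ; inverse = (λ x → pointwise⇒≈ λ n → ℚₚ.+-inverseˡ (seq x n)) ,
                      (λ x → pointwise⇒≈ λ n → ℚₚ.+-inverseʳ (seq x n))
          ; ⁻¹-cong = λ (mk≈ p q) → mk≈ (-‿antimono-≤ q) (-‿antimono-≤ p)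
          }
        ; comm = λ x y → pointwise⇒≈ λ n → ℚₚ.+-comm (seq x n) (seq y n)
        }
      ; *-cong = λ p q → mk≈ (*-cong-≤ p q) (*-cong-≤ (≈-sym p) (≈-sym q))
      ; *-assoc = λ x y z → pointwise⇒≈ λ n → ℚₚ.*-assoc (seq x n) (seq y n) (seq z n)
      ; *-identity = (λ x → pointwise⇒≈ λ n → ℚₚ.*-identityˡ (seq x n)) ,
                     (λ x → pointwise⇒≈ λ n → ℚₚ.*-identityʳ (seq x n))
      ; distrib = (λ x y z → pointwise⇒≈ λ n → ℚₚ.*-distribˡ-+ (seq x n) (seq y n) (seq z n)) ,
                  (λ x y z → pointwise⇒≈ λ n → ℚₚ.*-distribʳ-+ (seq x n) (seq y n) (seq z n))
      }
    ; *-comm = λ x y → pointwise⇒≈ λ n → ℚₚ.*-comm (seq x n) (seq y n)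
    }
  }

x≤x⊔y : ∀ x y → x ≤ x ⊔ y
x≤x⊔y x y = pointwise⇒≤ λ n → ℚₚ.p≤p⊔q (seq x n) (seq y n)

y≤x⊔y : ∀ x y → y ≤ x ⊔ y
y≤x⊔y x y = pointwise⇒≤ λ n → ℚₚ.p≤q⊔p (seq x n) (seq y n)

⊔-lub : ∀ {x y z} → x ≤ z → y ≤ z → x ⊔ y ≤ z
⊔-lub (mk≤ p) (mk≤ q) = mk≤ λ ε 0<ε → zipᵉ (p ε 0<ε) (q ε 0<ε) (λ n → ℚₚ.⊔-lub)

neg-small : ∀ {p δ} → 0ℚ ℚ.≤ p ℚ.+ δ → p ℚ.≤ 0ℚ → ℚ.∣ p ∣ ℚ.≤ δ
neg-small {p} {δ} h p≤0 = ∣p∣≤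
  (ℚₚ.≤-trans p≤0 (p+d≡q⇒p≤q (0≤p+q h (p≤q⇒0≤q-p p≤0)) (e₁ p δ)))
  (p+d≡q⇒p≤q h (e₂ p δ))
  where
  e₁ : ∀ p δ → 0ℚ ℚ.+ (p ℚ.+ δ ℚ.+ (0ℚ ℚ.- p)) ≡ δ
  e₁ = ring-solve ℚ-ring
  e₂ : ∀ p δ → ℚ.- p ℚ.+ (p ℚ.+ δ) ≡ δ
  e₂ = ring-solve ℚ-ring

nonneg-step : ∀ {p q B C δ₁ δ₂ ε} → 0ℚ ℚ.≤ ε → B ℚ.* δ₁ ≡ ε → C ℚ.* δ₂ ≡ ε →
              0ℚ ℚ.≤ p ℚ.+ δ₂ → 0ℚ ℚ.≤ q ℚ.+ δ₁ → ℚ.∣ p ∣ ℚ.≤ B → ℚ.∣ q ∣ ℚ.≤ C →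
              0ℚ ℚ.≤ p ℚ.* q ℚ.+ ε
nonneg-step {p} {q} {B} {C} {δ₁} {δ₂} {ε} 0≤ε e₁ e₂ hp hq bp bq with ℚₚ.≤-total 0ℚ p | ℚₚ.≤-total 0ℚ q
... | inj₁ 0≤p | inj₁ 0≤q = 0≤p+q (0≤p*q 0≤p 0≤q) 0≤ε
... | inj₂ p≤0 | _        = p+d≡q⇒p≤q (p≤q⇒0≤q-p (ℚₚ.≤-trans (p≤∣p∣ _) (subst (ℚ.∣ ℚ.- (p ℚ.* q) ∣ ℚ.≤_) e₂
                              (subst (ℚ._≤ C ℚ.* δ₂) (≡.sym (ℚₚ.∣-p∣≡∣p∣ (p ℚ.* q))) (*-bound {p} {q} (neg-small hp p≤0) bq))))) (e p q ε)
  where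
  e : ∀ p q ε → 0ℚ ℚ.+ (ε ℚ.- (ℚ.- (p ℚ.* q))) ≡ p ℚ.* q ℚ.+ ε
  e = ring-solve ℚ-ring
... | inj₁ _ | inj₂ q≤0   = p+d≡q⇒p≤q (p≤q⇒0≤q-p (ℚₚ.≤-trans (p≤∣p∣ _) (subst (ℚ.∣ ℚ.- (q ℚ.* p) ∣ ℚ.≤_) e₁
                              (subst (ℚ._≤ B ℚ.* δ₁) (≡.sym (ℚₚ.∣-p∣≡∣p∣ (q ℚ.* p))) (*-bound {q} {p} (neg-small hq q≤0) bp))))) (e p q ε)
  where
  e : ∀ p q ε → 0ℚ ℚ.+ (ε ℚ.- (ℚ.- (q ℚ.* p))) ≡ p ℚ.* q ℚ.+ ε
  e = ring-solve ℚ-ring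

*-nonneg : ∀ {x y} → 0ℝ ≤ x → 0ℝ ≤ y → 0ℝ ≤ x * y
*-nonneg {x} {y} (mk≤ hx) (mk≤ hy) = mk≤ λ ε 0<ε →
  let B , 0<B , hB     = eventually-bounded x
      C , 0<C , hC     = eventually-bounded y
      δ₁ , 0<δ₁ , eq₁  = quotient {B} {ε} 0<B 0<ε
      δ₂ , 0<δ₂ , eq₂  = quotient {C} {ε} 0<C 0<ε
  in zipᵉ (bothᵉ hB hC) (bothᵉ (hx δ₂ 0<δ₂) (hy δ₁ 0<δ₁)) (λ n (b , c) (p , q) →
       nonneg-step {seq x n} {seq y n} {B} {C} {δ₁} {δ₂} {ε} (ℚₚ.<⇒≤ 0<ε) eq₁ eq₂ p q b c)

log₂-cauchy : ∀ x → 0ℝ < x → IsCauchy (λ n → log₂≈ (seq x n) n)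
log₂-cauchy x (mk< e 0<e (N₀ , pos)) = cauchy-intro (λ n → log₂≈ (seq x n) n) λ ε 0<ε →
  let k , k≤ = archimedean (half 0<ε)
      j , j≤ = archimedean (half (half 0<ε))
      v      = k ℕ.+ suc k
      N₁ , close = cauchy-elim x (1/1+ v ℚ.* e) (0<p*q (0<1/1+ v) 0<e)
  in N₀ ℕ.⊔ N₁ ℕ.⊔ j , λ m n hm hn →
    let m₀ = ℕₚ.≤-trans (ℕₚ.≤-trans (ℕₚ.m≤m⊔n N₀ N₁) (ℕₚ.m≤m⊔n _ j)) hm
        n₀ = ℕₚ.≤-trans (ℕₚ.≤-trans (ℕₚ.m≤m⊔n N₀ N₁) (ℕₚ.m≤m⊔n _ j)) hn
        m₁ = ℕₚ.≤-trans (ℕₚ.≤-trans (ℕₚ.m≤n⊔m N₀ N₁) (ℕₚ.m≤m⊔n _ j)) hm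
        n₁ = ℕₚ.≤-trans (ℕₚ.≤-trans (ℕₚ.m≤n⊔m N₀ N₁) (ℕₚ.m≤m⊔n _ j)) hn
        jm = ℕₚ.≤-trans (ℕₚ.m≤n⊔m (N₀ ℕ.⊔ N₁) j) hm
        jn = ℕₚ.≤-trans (ℕₚ.m≤n⊔m (N₀ ℕ.⊔ N₁) j) hn
    in ℚₚ.≤-trans
         (log₂≈-compare (positive m m₀) (positive n n₀) k v refl
           (ℚₚ.≤-trans (close m n m₁ n₁) (ℚₚ.+-monoʳ-≤ (seq x n)
             (ℚₚ.*-monoˡ-≤-nonNeg (1/1+ v) {{ℚ.nonNegative (ℚₚ.<⇒≤ (0<1/1+ v))}} (e≤ m m₀)))) m n)
         (ℚₚ.+-monoʳ-≤ (log₂≈ (seq x n) n)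
           (ℚₚ.≤-trans (ℚₚ.+-mono-≤ k≤ (ℚₚ.+-mono-≤ (ℚₚ.≤-trans (1/1+-antimono jm) j≤) (ℚₚ.≤-trans (1/1+-antimono jn) j≤)))
             (ℚₚ.≤-reflexive (≡.trans (cong (½ ℚ.* ε ℚ.+_) (½*p+½*p≡p (½ ℚ.* ε))) (½*p+½*p≡p ε)))))
  where
  e≤ : ∀ n → N₀ ℕ.≤ n → e ℚ.≤ seq x n
  e≤ n h = subst (ℚ._≤ seq x n) (ℚₚ.+-identityˡ e) (pos n h)
  positive : ∀ n → N₀ ℕ.≤ n → 0ℚ ℚ.< seq x n
  positive n h = ℚₚ.<-≤-trans 0<e (e≤ n h)

-- The real number represented does not depend on the positivity proof or on the
-- representing sequence of x; only Cauchyness needs x to be bounded away from 0.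
log₂ : (x : ℝ) → 0ℝ < x → ℝ
seq    (log₂ x 0<x) n = log₂≈ (seq x n) n
cauchy (log₂ x 0<x) = log₂-cauchy x 0<x

<⇒≤ : ∀ {x y} → x < y → x ≤ y
<⇒≤ {x} {y} (mk< δ 0<δ x<y) = mk≤ λ ε 0<ε → mapᵉ x<y λ n h →
  p+d≡q⇒p≤q {seq x n} {seq y n ℚ.+ ε} (0≤p+q (p≤q⇒0≤q-p h) (0≤p+q (ℚₚ.<⇒≤ 0<δ) (ℚₚ.<⇒≤ 0<ε)))
    (eq (seq x n) (seq y n) δ ε)
  where
  eq : ∀ p q δ ε → p ℚ.+ (q ℚ.- (p ℚ.+ δ) ℚ.+ (δ ℚ.+ ε)) ≡ q ℚ.+ ε
  eq = ring-solve ℚ-ring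

≮⇒≥ : ∀ {x y} → ¬ (x < y) → y ≤ x
≮⇒≥ {x} {y} x≮y = mk≤ λ ε 0<ε →
  let t        = ½ ℚ.* (½ ℚ.* ε)
      u        = ½ ℚ.* t
      0<t      = half (half 0<ε)
      M , hx   = cauchy-elim x u (half 0<t)
      N , hy   = cauchy-elim y u (half 0<t)
      K        = M ℕ.⊔ N
      M≤K      = ℕₚ.m≤m⊔n M N
      N≤K      = ℕₚ.m≤n⊔m M N
  in decide ε 0<ε K (λ m n hm hn → hx m n (ℕₚ.≤-trans M≤K hm) (ℕₚ.≤-trans M≤K hn))
                    (λ m n hm hn → hy m n (ℕₚ.≤-trans N≤K hm) (ℕₚ.≤-trans N≤K hn))
  where
  decide : ∀ ε → 0ℚ ℚ.< ε → ∀ K →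
    (∀ m n → K ℕ.≤ m → K ℕ.≤ n → seq x m ℚ.≤ seq x n ℚ.+ ½ ℚ.* (½ ℚ.* (½ ℚ.* ε))) →
    (∀ m n → K ℕ.≤ m → K ℕ.≤ n → seq y m ℚ.≤ seq y n ℚ.+ ½ ℚ.* (½ ℚ.* (½ ℚ.* ε))) →
    Eventually (λ n → seq y n ℚ.≤ seq x n ℚ.+ ε)
  decide ε 0<ε K hx hy with seq x K ℚ.+ ½ ℚ.* ε ℚₚ.≤? seq y K
  ... | yes h = contradiction (mk< t (half (half 0<ε)) (K , λ n K≤n →
          apart (seq x n) (seq x K) (seq y K) (seq y n) (hx n K K≤n ℕₚ.≤-refl) h (hy K n ℕₚ.≤-refl K≤n))) x≮y
    where
    t = ½ ℚ.* (½ ℚ.* ε)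
    u = ½ ℚ.* t
    eq : ∀ p p′ q q′ u t s → p ℚ.+ t ℚ.+ (p′ ℚ.+ u ℚ.- p ℚ.+ (q ℚ.- (p′ ℚ.+ s) ℚ.+ (q′ ℚ.+ u ℚ.- q))) ≡ q′ ℚ.+ (u ℚ.+ u ℚ.+ t ℚ.- s)
    eq = ring-solve ℚ-ring
    apart : ∀ p p′ q q′ → p ℚ.≤ p′ ℚ.+ u → p′ ℚ.+ ½ ℚ.* ε ℚ.≤ q → q ℚ.≤ q′ ℚ.+ u → p ℚ.+ t ℚ.≤ q′
    apart p p′ q q′ h₁ h₂ h₃ = p+d≡q⇒p≤q
      (0≤p+q (p≤q⇒0≤q-p h₁) (0≤p+q (p≤q⇒0≤q-p h₂) (p≤q⇒0≤q-p h₃)))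
      (≡.trans (eq p p′ q q′ u t (½ ℚ.* ε)) (≡.trans (cong (q′ ℚ.+_)
        (≡.trans (cong (λ z → z ℚ.+ t ℚ.- ½ ℚ.* ε) (½*p+½*p≡p t))
          (≡.trans (cong (ℚ._- ½ ℚ.* ε) (½*p+½*p≡p (½ ℚ.* ε))) (ℚₚ.+-inverseʳ (½ ℚ.* ε)))))
        (ℚₚ.+-identityʳ q′)))
  ... | no ¬h = K , λ n K≤n →
          close (seq y n) (seq y K) (seq x K) (seq x n) (hy n K K≤n ℕₚ.≤-refl) (ℚₚ.<⇒≤ (ℚₚ.≰⇒> ¬h)) (hx K n ℕₚ.≤-refl K≤n)
    where
    t = ½ ℚ.* (½ ℚ.* ε)
    u = ½ ℚ.* t
    eq : ∀ p p′ q q′ u t s → p ℚ.+ (p′ ℚ.+ u ℚ.- p ℚ.+ (q ℚ.+ s ℚ.- p′ ℚ.+ (q′ ℚ.+ u ℚ.- q) ℚ.+ t)) ≡ q′ ℚ.+ (u ℚ.+ u ℚ.+ t ℚ.+ s)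
    eq = ring-solve ℚ-ring
    close : ∀ p p′ q q′ → p ℚ.≤ p′ ℚ.+ u → p′ ℚ.≤ q ℚ.+ ½ ℚ.* ε → q ℚ.≤ q′ ℚ.+ u → p ℚ.≤ q′ ℚ.+ ε
    close p p′ q q′ h₁ h₂ h₃ = p+d≡q⇒p≤q
      (0≤p+q (p≤q⇒0≤q-p h₁) (0≤p+q (0≤p+q (p≤q⇒0≤q-p h₂) (p≤q⇒0≤q-p h₃)) (ℚₚ.<⇒≤ (half (half 0<ε)))))
      (≡.trans (eq p p′ q q′ u t (½ ℚ.* ε)) (cong (q′ ℚ.+_)
        (≡.trans (cong (λ z → z ℚ.+ t ℚ.+ ½ ℚ.* ε) (½*p+½*p≡p t))
          (≡.trans (cong (ℚ._+ ½ ℚ.* ε) (½*p+½*p≡p (½ ℚ.* ε))) (½*p+½*p≡p ε)))))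

module ℝ-ring = CommutativeRing +-*-commutativeRing
open import Algebra.Properties.Semiring.Sum ℝ-ring.semiring
  using (sum; sum-cong-≋; ∑-comm; *-distribˡ-sum; *-distribʳ-sum; sum-replicate-zero)

-- Nonempty finite sets.
record FinSet⁺ : Set₁ where
  field
    Carrier   : Set
    pred-size : ℕ
    enum      : Carrier ↔ Fin (suc pred-size)

  elem : Fin (suc pred-size) → Carrier
  elem = Inverse.from enum

open FinSet⁺ using (Carrier; elem)

infixr 2 _×ᶠ_

_×ᶠ_ : FinSet⁺ → FinSet⁺ → FinSet⁺
A ×ᶠ B = record
  { Carrier   = Carrier A × Carrier B
  ; pred-size = FinSet⁺.pred-size B ℕ.+ FinSet⁺.pred-size A ℕ.* suc (FinSet⁺.pred-size B)
  ; enum      = ↔-sym Finₚ.*↔× ↔-∘ (FinSet⁺.enum A ×-↔ FinSet⁺.enum B)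
  }

∑ : (A : FinSet⁺) → (Carrier A → ℝ) → ℝ
∑ A f = sum (f ∘ elem A)

max : ∀ {n} → (Fin (suc n) → ℝ) → ℝ
max {zero}  f = f zero
max {suc n} f = f zero ⊔ max (f ∘ suc)

Max : (A : FinSet⁺) → (Carrier A → ℝ) → ℝ
Max A f = max (f ∘ elem A)

infix 5 ∑-syntax Max-syntax

∑-syntax : (A : FinSet⁺) → (Carrier A → ℝ) → ℝ
∑-syntax = ∑

Max-syntax : (A : FinSet⁺) → (Carrier A → ℝ) → ℝ
Max-syntax = Max

syntax ∑-syntax A (λ a → e) = ∑[ a ∈ A ] e
syntax Max-syntax A (λ a → e) = Max[ a ∈ A ] e

sum-mono : ∀ {n} {f h : Fin n → ℝ} → (∀ i → f i ≤ h i) → sum f ≤ sum h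
sum-mono {zero}  p = ≤-refl
sum-mono {suc n} p = +-mono-≤ (p zero) (sum-mono (p ∘ suc))

f≤max : ∀ {n} (f : Fin (suc n) → ℝ) i → f i ≤ max f
f≤max {zero}  f zero    = ≤-refl
f≤max {suc n} f zero    = x≤x⊔y (f zero) (max (f ∘ suc))
f≤max {suc n} f (suc i) = ≤-trans (f≤max (f ∘ suc) i) (y≤x⊔y (f zero) (max (f ∘ suc)))

max-lub : ∀ {n} (f : Fin (suc n) → ℝ) {b} → (∀ i → f i ≤ b) → max f ≤ b
max-lub {zero}  f p = p zero
max-lub {suc n} f p = ⊔-lub (p zero) (max-lub (f ∘ suc) (p ∘ suc))

elem-surjective : (A : FinSet⁺) (a : Carrier A) → elem A (Inverse.to (FinSet⁺.enum A) a) ≡ a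
elem-surjective A = Inverse.strictlyInverseʳ (FinSet⁺.enum A)

f≤Max : (A : FinSet⁺) (f : Carrier A → ℝ) (a : Carrier A) → f a ≤ Max A f
f≤Max A f a = subst (λ z → f z ≤ Max A f) (elem-surjective A a) (f≤max (f ∘ elem A) _)

∑-× : (A B : FinSet⁺) (f : Carrier A → Carrier B → ℝ) →
      ∑ (A ×ᶠ B) (λ p → f (proj₁ p) (proj₂ p)) ≈ ∑ A (λ a → ∑ B (f a))
∑-× A B f = sum-remQuot (λ i j → f (elem A i) (elem B j))
  where
  open ℝ-ring using (reflexive; sym; trans; +-cong; +-congˡ; +-assoc; +-identityˡ)

  sum-++ : ∀ m n (h : Fin (m ℕ.+ n) → ℝ) →
           sum h ≈ sum (λ i → h (i ↑ˡ n)) + sum (λ j → h (m ↑ʳ j))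
  sum-++ zero    n h = sym (+-identityˡ _)
  sum-++ (suc m) n h = trans (+-congˡ (sum-++ m n (h ∘ suc))) (sym (+-assoc _ _ _))

  sum-remQuot : ∀ {m n} (h : Fin m → Fin n → ℝ) →
    sum {m ℕ.* n} (λ k → h (proj₁ (remQuot n k)) (proj₂ (remQuot {m} n k))) ≈ sum (λ i → sum (h i))
  sum-remQuot {zero}  {n} h = ≈-refl
  sum-remQuot {suc m} {n} h = trans (sum-++ n (m ℕ.* n) _) (+-cong
    (sum-cong-≋ {n} (λ j → reflexive (cong (λ p → h (proj₁ p) (proj₂ p)) (Finₚ.remQuot-combine {suc m} {n} zero j))))
    (trans (sum-cong-≋ {m ℕ.* n} (λ k → reflexive (shift k))) (sum-remQuot (h ∘ suc))))
    where
    shift : ∀ k → h (proj₁ (remQuot {suc m} n (n ↑ʳ k))) (proj₂ (remQuot {suc m} n (n ↑ʳ k)))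
                ≡ h (suc (proj₁ (remQuot {m} n k))) (proj₂ (remQuot {m} n k))
    shift k rewrite Finₚ.splitAt-↑ʳ n (m ℕ.* n) k = refl

record Prior (X : FinSet⁺) : Set where
  field
    prob   : Carrier X → ℝ
    nonneg : ∀ x → 0ℝ ≤ prob x
    total  : ∑[ x ∈ X ] prob x ≈ 1ℝ

record Channel (X Y : FinSet⁺) : Set where
  field
    entry  : Carrier X → Carrier Y → ℝ
    nonneg : ∀ x y → 0ℝ ≤ entry x y
    total  : ∀ x → ∑[ y ∈ Y ] entry x y ≈ 1ℝ

record GainFunction (W X : FinSet⁺) : Set where
  field
    gain   : Carrier W → Carrier X → ℝ
    nonneg : ∀ w x → 0ℝ ≤ gain w x
    ≤one   : ∀ w x → gain w x ≤ 1ℝ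

open Prior using (prob)
open Channel using (entry)
open GainFunction using (gain)

infixr 7 _∥_

_∥_ : ∀ {X Y₁ Y₂} → Channel X Y₁ → Channel X Y₂ → Channel X (Y₁ ×ᶠ Y₂)
_∥_ {X} {Y₁} {Y₂} C₁ C₂ = record
  { entry  = λ x (y₁ , y₂) → entry C₁ x y₁ * entry C₂ x y₂
  ; nonneg = λ x (y₁ , y₂) → *-nonneg (Channel.nonneg C₁ x y₁) (Channel.nonneg C₂ x y₂)
  ; total  = λ x → begin
      ∑ (Y₁ ×ᶠ Y₂) (λ p → entry C₁ x (proj₁ p) * entry C₂ x (proj₂ p))
        ≈⟨ ∑-× Y₁ Y₂ (λ y₁ y₂ → entry C₁ x y₁ * entry C₂ x y₂) ⟩
      ∑ Y₁ (λ y₁ → ∑ Y₂ (λ y₂ → entry C₁ x y₁ * entry C₂ x y₂))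
        ≈⟨ sum-cong-≋ (λ i → *-distribˡ-sum (entry C₁ x (elem Y₁ i)) (entry C₂ x ∘ elem Y₂)) ⟨
      ∑ Y₁ (λ y₁ → entry C₁ x y₁ * ∑ Y₂ (entry C₂ x))
        ≈⟨ *-distribʳ-sum (∑ Y₂ (entry C₂ x)) (entry C₁ x ∘ elem Y₁) ⟨
      ∑ Y₁ (entry C₁ x) * ∑ Y₂ (entry C₂ x)
        ≈⟨ *-cong (Channel.total C₁ x) (Channel.total C₂ x) ⟩
      1ℝ * 1ℝ
        ≈⟨ *-identityˡ 1ℝ ⟩
      1ℝ ∎
  }
  where
  open ℝ-ring using (setoid; *-cong; *-identityˡ)
  open Relation.Binary.Reasoning.Setoid setoid

V : ∀ {W X} → GainFunction W X → Prior X → ℝ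
V {W} {X} g π = Max[ w ∈ W ] ∑[ x ∈ X ] prob π x * gain g w x

Vᶜ : ∀ {W X Y} → GainFunction W X → Prior X → Channel X Y → ℝ
Vᶜ {W} {X} {Y} g π C = ∑[ y ∈ Y ] Max[ w ∈ W ] ∑[ x ∈ X ] prob π x * entry C x y * gain g w x

V≤Vᶜ : ∀ {W X Y} (g : GainFunction W X) (π : Prior X) (C : Channel X Y) → V g π ≤ Vᶜ g π C
V≤Vᶜ {W} {X} {Y} g π C = max-lub _ λ i → let w = elem W i in
  ≤-trans (≈⇒≤ (expand w))
    (sum-mono (λ j → f≤max (λ i′ → ∑ X (λ x → prob π x * entry C x (elem Y j) * gain g (elem W i′) x)) i))
  where
  open ℝ-ring using (setoid; *-cong; *-congˡ; *-congʳ; *-identityʳ; *-assoc; *-comm; sym; trans)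
  open Relation.Binary.Reasoning.Setoid setoid

  row : ∀ w x → prob π x * gain g w x ≈ ∑ Y (λ y → prob π x * entry C x y * gain g w x)
  row w x = begin
    p * h                                   ≈⟨ *-congʳ (*-identityʳ p) ⟨
    p * 1ℝ * h                              ≈⟨ *-congʳ (*-congˡ (Channel.total C x)) ⟨
    p * ∑ Y (entry C x) * h                 ≈⟨ *-congʳ (*-distribˡ-sum p (entry C x ∘ elem Y)) ⟩
    ∑ Y (λ y → p * entry C x y) * h         ≈⟨ *-distribʳ-sum h (λ j → p * entry C x (elem Y j)) ⟩
    ∑ Y (λ y → p * entry C x y * h)         ∎
    where
    p = prob π x
    h = gain g w x

  expand : ∀ w → ∑ X (λ x → prob π x * gain g w x) ≈
                 ∑ Y (λ y → ∑ X (λ x → prob π x * entry C x y * gain g w x))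
  expand w = trans (sum-cong-≋ (λ k → row w (elem X k)))
    (∑-comm (λ k j → prob π (elem X k) * entry C (elem X k) (elem Y j) * gain g w (elem X k)))

Vᶜ-positive : ∀ {W X Y} (g : GainFunction W X) (π : Prior X) (C : Channel X Y) →
              0ℝ < V g π → 0ℝ < Vᶜ g π C
Vᶜ-positive g π C V>0 = <-≤-trans V>0 (V≤Vᶜ g π C)

H : ∀ {W X} (g : GainFunction W X) (π : Prior X) → 0ℝ < V g π → ℝ
H g π V>0 = - log₂ (V g π) V>0

Hᶜ : ∀ {W X Y} (g : GainFunction W X) (π : Prior X) → 0ℝ < V g π → Channel X Y → ℝ
Hᶜ g π V>0 C = - log₂ (Vᶜ g π C) (Vᶜ-positive g π C V>0)

I : ∀ {W X Y} (g : GainFunction W X) (π : Prior X) → 0ℝ < V g π → Channel X Y → ℝ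
I g π V>0 C = H g π V>0 - Hᶜ g π V>0 C

-- "min S" as data: an element of S below all others. Selecting the minimum of the
-- nonzero π[x] g(w,x) requires deciding which reals vanish, so it cannot be computed
-- from g and π; minimum-¬¬-exists below shows that it always exists classically.
record Minimum (S : ℝ → Set) : Set where
  field
    value    : ℝ
    attained : S value
    least    : ∀ r → S r → value ≤ r

NonzeroProducts : ∀ {W X} → GainFunction W X → Prior X → ℝ → Set
NonzeroProducts {W} {X} g π r =
  ∃[ x ] ∃[ w ] r ≈ prob π x * gain g w x × prob π x * gain g w x # 0ℝ

minimum-positive : ∀ {W X} (g : GainFunction W X) (π : Prior X) (m : Minimum (NonzeroProducts g π)) →
                   0ℝ < Minimum.value m
minimum-positive g π m with Minimum.attained m
... | x , w , m≈ , inj₁ <0 = contradiction <0 (≤⇒≯ (*-nonneg (Prior.nonneg π x) (GainFunction.nonneg g w x)))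
... | x , w , m≈ , inj₂ >0 = <-≤-trans >0 (≈⇒≥ m≈)

Hᵐⁱⁿ : ∀ {W X} (g : GainFunction W X) (π : Prior X) → Minimum (NonzeroProducts g π) → ℝ
Hᵐⁱⁿ g π m = - log₂ (Minimum.value m) (minimum-positive g π m)

¬¬-least-positive : ∀ {n} (f : Fin n → ℝ) →
  ¬ ¬ ((∀ i → ¬ 0ℝ < f i) ⊎ (∃[ i ] 0ℝ < f i × (∀ j → 0ℝ < f j → f i ≤ f j)))
¬¬-least-positive {zero}  f k = k (inj₁ λ ())
¬¬-least-positive {suc n} f k = ¬¬-least-positive (f ∘ suc) λ where
  (inj₁ none)         → ¬¬-excluded-middle λ where
    (yes 0<f₀) → k (inj₂ (zero , 0<f₀ , λ where
      zero    _    → ≤-refl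
      (suc j) 0<fⱼ → contradiction 0<fⱼ (none j)))
    (no  0≮f₀) → k (inj₁ λ where
      zero    → 0≮f₀
      (suc j) → none j)
  (inj₂ (i , 0<fᵢ , least)) → ¬¬-excluded-middle λ where
    (no  0≮f₀) → k (inj₂ (suc i , 0<fᵢ , λ where
      zero    0<f₀ → contradiction 0<f₀ 0≮f₀
      (suc j)      → least j))
    (yes 0<f₀) → ¬¬-excluded-middle λ where
      (yes f₀<fᵢ) → k (inj₂ (zero , 0<f₀ , λ where
        zero    _    → ≤-refl
        (suc j) 0<fⱼ → ≤-trans (<⇒≤ f₀<fᵢ) (least j 0<fⱼ)))
      (no  f₀≮fᵢ) → k (inj₂ (suc i , 0<fᵢ , λ where
        zero    _    → ≮⇒≥ f₀≮fᵢ
        (suc j)      → least j))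

minimum-¬¬-exists : ∀ {W X} (g : GainFunction W X) (π : Prior X) → 0ℝ < V g π →
                    ¬ ¬ Minimum (NonzeroProducts g π)
minimum-¬¬-exists {W} {X} g π V>0 k = ¬¬-least-positive (product ∘ elem (X ×ᶠ W)) (λ where
  (inj₁ none)               → ≤⇒≯ (max-lub _ λ i → ≤-trans
    (sum-mono λ j → ≮⇒≥ {0ℝ} (absent none (elem X j , elem W i)))
    (≈⇒≤ (sum-replicate-zero (suc (FinSet⁺.pred-size X))))) V>0
  (inj₂ (i , 0<fᵢ , least)) → k (record
    { value    = product (elem (X ×ᶠ W) i)
    ; attained = proj₁ (elem (X ×ᶠ W) i) , proj₂ (elem (X ×ᶠ W) i) , ≈-refl , inj₂ 0<fᵢ
    ; least    = λ where
        r (x , w , r≈ , inj₁ <0) → contradiction <0 (≤⇒≯ (*-nonneg (Prior.nonneg π x) (GainFunction.nonneg g w x)))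
        r (x , w , r≈ , inj₂ >0) → ≤-trans (at least (x , w) >0) (≈⇒≥ r≈)
    }))
  where
  product : Carrier (X ×ᶠ W) → ℝ
  product (x , w) = prob π x * gain g w x

  index : Carrier (X ×ᶠ W) → Fin _
  index = Inverse.to (FinSet⁺.enum (X ×ᶠ W))

  absent : (∀ i → ¬ 0ℝ < product (elem (X ×ᶠ W) i)) → ∀ p → ¬ 0ℝ < product p
  absent none p = subst (λ q → ¬ 0ℝ < product q) (elem-surjective (X ×ᶠ W) p) (none (index p))

  at : ∀ {b} → (∀ j → 0ℝ < product (elem (X ×ᶠ W) j) → b ≤ product (elem (X ×ᶠ W) j)) →
       ∀ p → 0ℝ < product p → b ≤ product p
  at {b} least p = subst (λ q → 0ℝ < product q → b ≤ product q) (elem-surjective (X ×ᶠ W) p) (least (index p))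

{-# OPTIONS --safe #-}

-- Cancelling the logarithms of V, the claim is  m · V(π, C₁ ∥ C₂) ≤ V(π, C₁) · V(π, C₂)  for
-- m the least nonzero π[x] g(w,x).  Each a = π[x] g(w,x) satisfies  m · a ≤ a · a,  so for fixed
-- w, y₁, y₂ the sum  m · ∑ₓ π C₁ C₂ g  is at most the diagonal part of the product
-- (∑ₓ π C₁ g) · (∑ₓ π C₂ g);  then take maxima over w and sum over y₁ and y₂.
module Submission where

open import Defs
open import Algebra.Properties.Semiring.Sum ℝ-ring.semiring
  using (sum; sum-cong-≋; *-distribˡ-sum; *-distribʳ-sum)
open import Data.Fin using (Fin; zero; suc)
open import Data.Integer as ℤ using (ℤ; +_)
import Data.Integer.Properties as ℤₚ
open import Data.Integer.Tactic.RingSolver using () renaming (solve-∀ to ℤ-solve)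
open import Data.Nat as ℕ using (ℕ; zero; suc; _^_)
open import Data.Nat.Logarithm using (⌊log₂_⌋)
import Data.Nat.Properties as ℕₚ
open import Data.Product using (_,_; _×_; ∃-syntax; proj₁; proj₂)
open import Data.Rational as ℚ using (ℚ; 0ℚ; ½; ↥_; ↧ₙ_)
import Data.Rational.Properties as ℚₚ
open import Data.Rational.Unnormalised as ℚᵘ using (mkℚᵘ)
import Data.Rational.Unnormalised.Properties as ℚᵘₚ
open import Data.Sum using (inj₂)
open import Function using (_∘_)
open import Relation.Binary.Bundles using (Preorder)
open import Relation.Binary.PropositionalEquality as ≡ using (_≡_; refl; cong; subst; subst₂)
import Relation.Binary.Reasoning.Preorder
open import Relation.Nullary using (¬_; yes; no; ¬¬-excluded-middle)
open import Tactic.RingSolver using () renaming (solve-∀ to ring-solve)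

open FinSet⁺ using (Carrier; elem)
open Prior using (prob)
open Channel using (entry)
open GainFunction using (gain)

-- Order on the reals

≤-preorder : Preorder _ _ _
≤-preorder = record
  { Carrier    = ℝ
  ; _≈_        = _≈_
  ; _≲_        = _≤_
  ; isPreorder = record
    { isEquivalence = ℝ-ring.isEquivalence
    ; reflexive     = ≈⇒≤
    ; trans         = ≤-trans
    }
  }

module ≤-Reasoning = Relation.Binary.Reasoning.Preorder ≤-preorder

-- `x ≤ y` is equivalent to the negation of `y < x`, and a negation absorbs a double negation.
≤-stable : ∀ {x y} → ¬ ¬ (x ≤ y) → x ≤ y
≤-stable h = ≮⇒≥ λ y<x → h λ x≤y → ≤⇒≯ x≤y y<x

-- The order on `ℝ` is not decidable, so a case distinction on `x` and `y` proves the goal only up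
-- to double negation; `≤-stable` removes it because the goal is itself a `≤`.
≤-cases : ∀ {u v} x y → (x < y → u ≤ v) → (y ≤ x → u ≤ v) → u ≤ v
≤-cases x y below above = ≤-stable λ k → ¬¬-excluded-middle λ where
  (yes x<y) → k (below x<y)
  (no  x≮y) → k (above (≮⇒≥ x≮y))

x+d≈y⇒x≤y : ∀ {x y d} → 0ℝ ≤ d → x + d ≈ y → x ≤ y
x+d≈y⇒x≤y {x} 0≤d x+d≈y =
  ≤-trans (≈⇒≥ (ℝ-ring.+-identityʳ x)) (≤-trans (+-mono-≤ ≤-refl 0≤d) (≈⇒≤ x+d≈y))

x≤y⇒0≤y-x : ∀ {x y} → x ≤ y → 0ℝ ≤ y - x
x≤y⇒0≤y-x {x} x≤y = ≤-trans (≈⇒≥ (ℝ-ring.-‿inverseʳ x)) (+-mono-≤ x≤y ≤-refl)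

*-monoˡ-≤-nonneg : ∀ {c x y} → 0ℝ ≤ c → x ≤ y → c * x ≤ c * y
*-monoˡ-≤-nonneg {c} {x} {y} 0≤c x≤y = x+d≈y⇒x≤y (*-nonneg 0≤c (x≤y⇒0≤y-x x≤y))
  -- Ring operations on reals act termwise, so an identity in `ℚ` at every index suffices.
  (pointwise⇒≈ λ n → eq (seq c n) (seq x n) (seq y n))
  where
  eq : ∀ c x y → c ℚ.* x ℚ.+ c ℚ.* (y ℚ.- x) ≡ c ℚ.* y
  eq = ring-solve ℚ-ring

-- The intermediate term is `x * y′`, so nonnegativity is asked of the two factors that are held
-- fixed in turn.
*-mono-≤-nonneg : ∀ {x x′ y y′} → 0ℝ ≤ x → 0ℝ ≤ y′ → x ≤ x′ → y ≤ y′ → x * y ≤ x′ * y′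
*-mono-≤-nonneg {x} {x′} {y} {y′} 0≤x 0≤y′ x≤x′ y≤y′ = begin
  x  * y     ≲⟨ *-monoˡ-≤-nonneg 0≤x y≤y′ ⟩
  x  * y′    ≈⟨ ℝ-ring.*-comm x y′ ⟩
  y′ * x     ≲⟨ *-monoˡ-≤-nonneg 0≤y′ x≤x′ ⟩
  y′ * x′    ≈⟨ ℝ-ring.*-comm y′ x′ ⟩
  x′ * y′    ∎
  where open ≤-Reasoning

eventually-bounded-below : ∀ {x} → 0ℝ < x → ∃[ e ] 0ℚ ℚ.< e × Eventually (λ n → e ℚ.≤ seq x n)
eventually-bounded-below {x} (mk< e 0<e pos) =
  e , 0<e , mapᵉ pos λ n → subst (ℚ._≤ seq x n) (ℚₚ.+-identityˡ e)

eventually-positive : ∀ {x} → 0ℝ < x → Eventually (λ n → 0ℚ ℚ.< seq x n)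
eventually-positive 0<x = let e , 0<e , e≤ = eventually-bounded-below 0<x in
  mapᵉ e≤ λ n → ℚₚ.<-≤-trans 0<e

*-positive : ∀ {x y} → 0ℝ < x → 0ℝ < y → 0ℝ < x * y
*-positive {x} {y} 0<x 0<y =
  let a , 0<a , a≤ = eventually-bounded-below 0<x
      b , 0<b , b≤ = eventually-bounded-below 0<y
  in mk< (a ℚ.* b) (0<p*q 0<a 0<b) (zipᵉ a≤ b≤ λ n → step 0<a 0<b)
  where
  step : ∀ {a b p q} → 0ℚ ℚ.< a → 0ℚ ℚ.< b → a ℚ.≤ p → b ℚ.≤ q → 0ℚ ℚ.+ a ℚ.* b ℚ.≤ p ℚ.* q
  step {a} {b} {p} {q} 0<a 0<b a≤p b≤q = begin
    0ℚ ℚ.+ a ℚ.* b   ≡⟨ ℚₚ.+-identityˡ _ ⟩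
    a ℚ.* b          ≤⟨ ℚₚ.*-monoʳ-≤-nonNeg b {{ℚ.nonNegative (ℚₚ.<⇒≤ 0<b)}} a≤p ⟩
    p ℚ.* b          ≤⟨ ℚₚ.*-monoˡ-≤-nonNeg p {{ℚ.nonNegative (ℚₚ.≤-trans (ℚₚ.<⇒≤ 0<a) a≤p)}} b≤q ⟩
    p ℚ.* q          ∎
    where open ℚₚ.≤-Reasoning

-- Logarithms

1/1+-eventually-≤ : ∀ {ε} → 0ℚ ℚ.< ε → Eventually (λ n → 1/1+ n ℚ.≤ ε)
1/1+-eventually-≤ 0<ε = let j , j≤ = archimedean 0<ε in
  j , λ n j≤n → ℚₚ.≤-trans (1/1+-antimono j≤n) j≤

-- `log₂≈-compare` allows a relative error, whereas `x ≤ y` supplies an additive one. An additive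
-- error of `1/1+ v` times a lower bound `e` for the terms of `x` is also a relative error of
-- `1/1+ v`.
log₂-mono-≤ : ∀ {x y} (0<x : 0ℝ < x) (0<y : 0ℝ < y) → x ≤ y → log₂ x 0<x ≤ log₂ y 0<y
log₂-mono-≤ {x} {y} 0<x 0<y (mk≤ x≤y) = mk≤ λ ε 0<ε →
  let e , 0<e , e≤ = eventually-bounded-below 0<x
      k , k≤       = archimedean (half 0<ε)
      -- This makes `suc v` twice `suc k`, the ratio at which `log₂≈-compare` loses `1/1+ k`.
      v            = k ℕ.+ suc k
  in zipᵉ (bothᵉ e≤ (bothᵉ (eventually-positive 0<x) (eventually-positive 0<y)))
          (bothᵉ (x≤y (1/1+ v ℚ.* e) (0<p*q (0<1/1+ v) 0<e)) (1/1+-eventually-≤ (half (half 0<ε))))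
       λ n (e≤x , 0<xₙ , 0<yₙ) (x≤y+ , n≤) → ℚₚ.≤-trans
         (log₂≈-compare 0<xₙ 0<yₙ k v refl
           (ℚₚ.≤-trans x≤y+ (ℚₚ.+-monoʳ-≤ (seq y n)
             (ℚₚ.*-monoˡ-≤-nonNeg (1/1+ v) {{ℚ.nonNegative (ℚₚ.<⇒≤ (0<1/1+ v))}} e≤x))) n n)
         -- The relative error costs at most `½ ℚ.* ε`, and each of the two rounding errors `1/1+ n`
         -- at most half of that.
         (ℚₚ.+-monoʳ-≤ (log₂≈ (seq y n) n)
           (ℚₚ.≤-trans (ℚₚ.+-mono-≤ k≤ (ℚₚ.+-mono-≤ n≤ n≤))
             (ℚₚ.≤-reflexive (≡.trans (cong (½ ℚ.* ε ℚ.+_) (½*p+½*p≡p (½ ℚ.* ε))) (½*p+½*p≡p ε)))))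

-- Powers of two bound the factors on the left from below and those on the right from above; each
-- upper bound costs one unit in the exponent. Three factors a side is the shape of a
-- cross-multiplied product of two fractions.
⌊log₂⌋-product-≤ : ∀ k a b c d e f →
  .{{ℕ.NonZero a}} → .{{ℕ.NonZero b}} → .{{ℕ.NonZero c}} →
  a ℕ.* (b ℕ.* c) ℕ.≤ d ℕ.* (e ℕ.* f) →
  ⌊log₂ a ^ k ⌋ ℕ.+ (⌊log₂ b ^ k ⌋ ℕ.+ ⌊log₂ c ^ k ⌋) ℕ.≤
  suc ⌊log₂ d ^ k ⌋ ℕ.+ (suc ⌊log₂ e ^ k ⌋ ℕ.+ suc ⌊log₂ f ^ k ⌋)
⌊log₂⌋-product-≤ k a b c d e f h = 2^-cancel-≤ _ _ (begin
    2 ^ (ℓ a ℕ.+ (ℓ b ℕ.+ ℓ c))                              ≡⟨ 2^-+-+ (ℓ a) (ℓ b) (ℓ c) ⟩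
    2 ^ ℓ a ℕ.* (2 ^ ℓ b ℕ.* 2 ^ ℓ c)                        ≤⟨ ℕₚ.*-mono-≤ (lower a) (ℕₚ.*-mono-≤ (lower b) (lower c)) ⟩
    a ^ k ℕ.* (b ^ k ℕ.* c ^ k)                              ≡⟨ ^-*-* a b c ⟨
    (a ℕ.* (b ℕ.* c)) ^ k                                    ≤⟨ ℕₚ.^-monoˡ-≤ k h ⟩
    (d ℕ.* (e ℕ.* f)) ^ k                                    ≡⟨ ^-*-* d e f ⟩
    d ^ k ℕ.* (e ^ k ℕ.* f ^ k)                              ≤⟨ ℕₚ.*-mono-≤ (≤2^1+⌊log₂⌋ (d ^ k)) (ℕₚ.*-mono-≤ (≤2^1+⌊log₂⌋ (e ^ k)) (≤2^1+⌊log₂⌋ (f ^ k))) ⟩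
    2 ^ suc (ℓ d) ℕ.* (2 ^ suc (ℓ e) ℕ.* 2 ^ suc (ℓ f))      ≡⟨ 2^-+-+ (suc (ℓ d)) (suc (ℓ e)) (suc (ℓ f)) ⟨
    2 ^ (suc (ℓ d) ℕ.+ (suc (ℓ e) ℕ.+ suc (ℓ f)))            ∎)
  where
  open ℕₚ.≤-Reasoning
  ℓ : ℕ → ℕ
  ℓ n = ⌊log₂ n ^ k ⌋
  lower : ∀ n → .{{ℕ.NonZero n}} → 2 ^ ℓ n ℕ.≤ n ^ k
  lower n = 2^⌊log₂⌋≤ (n ^ k) {{ℕₚ.m^n≢0 n k}}
  2^-+-+ : ∀ i j l → 2 ^ (i ℕ.+ (j ℕ.+ l)) ≡ 2 ^ i ℕ.* (2 ^ j ℕ.* 2 ^ l)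
  2^-+-+ i j l = ≡.trans (ℕₚ.^-distribˡ-+-* 2 i _) (cong (2 ^ i ℕ.*_) (ℕₚ.^-distribˡ-+-* 2 j l))
  ^-*-* : ∀ x y z → (x ℕ.* (y ℕ.* z)) ^ k ≡ x ^ k ℕ.* (y ^ k ℕ.* z ^ k)
  ^-*-* x y z = ≡.trans (^-distribʳ-* k x _) (cong (x ^ k ℕ.*_) (^-distribʳ-* k y z))

/-homo-+ : ∀ n i j → (i ℤ.+ j) ℚ./ suc n ≡ i ℚ./ suc n ℚ.+ j ℚ./ suc n
/-homo-+ n i j = ℚₚ.toℚᵘ-injective (begin
    ℚ.toℚᵘ ((i ℤ.+ j) ℚ./ suc n)                      ≈⟨ toℚᵘ-/ (i ℤ.+ j) n ⟩
    mkℚᵘ (i ℤ.+ j) n                                  ≈⟨ ℚᵘ.*≡* (eq i j (+ suc n)) ⟩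
    mkℚᵘ i n ℚᵘ.+ mkℚᵘ j n                            ≈⟨ ℚᵘₚ.+-cong (toℚᵘ-/ i n) (toℚᵘ-/ j n) ⟨
    ℚ.toℚᵘ (i ℚ./ suc n) ℚᵘ.+ ℚ.toℚᵘ (j ℚ./ suc n)    ≈⟨ ℚₚ.toℚᵘ-homo-+ (i ℚ./ suc n) (j ℚ./ suc n) ⟨
    ℚ.toℚᵘ (i ℚ./ suc n ℚ.+ j ℚ./ suc n)              ∎)
  where
  open import Relation.Binary.Reasoning.Setoid ℚᵘₚ.≃-setoid
  eq : ∀ i j N → (i ℤ.+ j) ℤ.* (N ℤ.* N) ≡ (i ℤ.* N ℤ.+ j ℤ.* N) ℤ.* N
  eq = ℤ-solve

/-mono-≤ : ∀ n {i j} → i ℤ.≤ j → i ℚ./ suc n ℚ.≤ j ℚ./ suc n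
/-mono-≤ n {i} {j} i≤j = ℚₚ.toℚᵘ-cancel-≤ (begin
    ℚ.toℚᵘ (i ℚ./ suc n)   ≃⟨ toℚᵘ-/ i n ⟩
    mkℚᵘ i n               ≤⟨ ℚᵘ.*≤* (ℤₚ.*-monoʳ-≤-nonNeg (+ suc n) i≤j) ⟩
    mkℚᵘ j n               ≃⟨ toℚᵘ-/ j n ⟨
    ℚ.toℚᵘ (j ℚ./ suc n)   ∎)
  where open ℚᵘₚ.≤-Reasoning

-- The three units lost in `⌊log₂⌋-product-≤`, at the scale of `log₂≈`.
3/1+ : ℕ → ℚ
3/1+ n = + 3 ℚ./ suc n

3/1+-eventually-≤ : ∀ {ε} → 0ℚ ℚ.< ε → Eventually (λ n → 3/1+ n ℚ.≤ ε)
3/1+-eventually-≤ {ε} 0<ε = mapᵉ (1/1+-eventually-≤ (half (half 0<ε))) λ n n≤ → begin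
    -- Rounding 3 up to 4 allows two halvings, down to `1/1+ n`, which is at most a quarter of `ε`.
    3/1+ n                               ≤⟨ /-mono-≤ n {+ 3} {+ 4} (ℤ.+≤+ (ℕₚ.n≤1+n 3)) ⟩
    (+ 2 ℤ.+ + 2) ℚ./ suc n              ≡⟨ /-homo-+ n (+ 2) (+ 2) ⟩
    + 2 ℚ./ suc n ℚ.+ + 2 ℚ./ suc n      ≤⟨ ℚₚ.+-mono-≤ (two n n≤) (two n n≤) ⟩
    ½ ℚ.* ε ℚ.+ ½ ℚ.* ε                  ≡⟨ ½*p+½*p≡p ε ⟩
    ε                                    ∎
  where
  open ℚₚ.≤-Reasoning
  two : ∀ n → 1/1+ n ℚ.≤ ½ ℚ.* (½ ℚ.* ε) → + 2 ℚ./ suc n ℚ.≤ ½ ℚ.* ε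
  two n n≤ = begin
    + 2 ℚ./ suc n                        ≡⟨ /-homo-+ n (+ 1) (+ 1) ⟩
    1/1+ n ℚ.+ 1/1+ n                    ≤⟨ ℚₚ.+-mono-≤ n≤ n≤ ⟩
    ½ ℚ.* (½ ℚ.* ε) ℚ.+ ½ ℚ.* (½ ℚ.* ε)  ≡⟨ ½*p+½*p≡p (½ ℚ.* ε) ⟩
    ½ ℚ.* ε                              ∎

-- The product in `ℚ` is reduced to lowest terms, so its numerator and denominator are tied to those
-- of `p` and `q` only through cross-multiplication.
*-cross-multiplied : ∀ p q →
  ℤ.∣ ↥ (p ℚ.* q) ∣ ℕ.* (↧ₙ p ℕ.* ↧ₙ q) ≡ ↧ₙ (p ℚ.* q) ℕ.* (ℤ.∣ ↥ p ∣ ℕ.* ℤ.∣ ↥ q ∣)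
*-cross-multiplied p q = cross p q (p ℚ.* q) (ℚₚ.toℚᵘ-homo-* p q)
  where
  open ≡.≡-Reasoning
  -- With r in place of p ℚ.* q, matching on all three makes ℚ.toℚᵘ compute.
  cross : ∀ p q r → ℚ.toℚᵘ r ℚᵘ.≃ ℚ.toℚᵘ p ℚᵘ.* ℚ.toℚᵘ q →
          ℤ.∣ ↥ r ∣ ℕ.* (↧ₙ p ℕ.* ↧ₙ q) ≡ ↧ₙ r ℕ.* (ℤ.∣ ↥ p ∣ ℕ.* ℤ.∣ ↥ q ∣)
  cross p@record{} q@record{} r@record{} (ℚᵘ.*≡* eq) = begin
    ℤ.∣ ↥ r ∣ ℕ.* (↧ₙ p ℕ.* ↧ₙ q)            ≡⟨ ℤₚ.abs-* (↥ r) (+ (↧ₙ p ℕ.* ↧ₙ q)) ⟨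
    ℤ.∣ ↥ r ℤ.* + (↧ₙ p ℕ.* ↧ₙ q) ∣          ≡⟨ cong ℤ.∣_∣ eq ⟩
    ℤ.∣ ↥ p ℤ.* ↥ q ℤ.* + ↧ₙ r ∣             ≡⟨ ℤₚ.abs-* (↥ p ℤ.* ↥ q) _ ⟩
    ℤ.∣ ↥ p ℤ.* ↥ q ∣ ℕ.* ↧ₙ r               ≡⟨ ℕₚ.*-comm _ (↧ₙ r) ⟩
    ↧ₙ r ℕ.* ℤ.∣ ↥ p ℤ.* ↥ q ∣               ≡⟨ cong (↧ₙ r ℕ.*_) (ℤₚ.abs-* (↥ p) (↥ q)) ⟩
    ↧ₙ r ℕ.* (ℤ.∣ ↥ p ∣ ℕ.* ℤ.∣ ↥ q ∣)       ∎

∣↥∣-nonZero : ∀ {p} → 0ℚ ℚ.< p → ℕ.NonZero ℤ.∣ ↥ p ∣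
∣↥∣-nonZero {p@record{}} 0<p = ℚₚ.pos⇒nonZero p {{ℚ.positive 0<p}}

module _ {p q : ℚ} (0<p : 0ℚ ℚ.< p) (0<q : 0ℚ ℚ.< q) (n : ℕ) where
  private
    ℓ : ℕ → ℕ
    ℓ k = ⌊log₂ k ^ suc n ⌋
    a b c d e f : ℕ
    a = ℤ.∣ ↥ p ∣
    b = ↧ₙ p
    c = ℤ.∣ ↥ q ∣
    d = ↧ₙ q
    e = ℤ.∣ ↥ (p ℚ.* q) ∣
    f = ↧ₙ (p ℚ.* q)
    instance
      a-nonZero : ℕ.NonZero a
      a-nonZero = ∣↥∣-nonZero 0<p
      c-nonZero : ℕ.NonZero c
      c-nonZero = ∣↥∣-nonZero 0<q
      e-nonZero : ℕ.NonZero e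
      e-nonZero = ∣↥∣-nonZero (0<p*q 0<p 0<q)

    P Q S : ℤ
    P = + ℓ a ℤ.- + ℓ b
    Q = + ℓ c ℤ.- + ℓ d
    S = + ℓ e ℤ.- + ℓ f

    sum-/ : (P ℤ.+ Q) ℚ./ suc n ≡ log₂≈ p n ℚ.+ log₂≈ q n
    sum-/ = /-homo-+ n P Q

    -- The equation of `e b d` with `f a c` bounds the logarithms of the former by those of the
    -- latter plus 3; subtracting those of `f`, `b` and `d` leaves the claim. `P+Q≤S+3` reads the
    -- equation in the other direction.
    S≤P+Q+3 : S ℤ.≤ P ℤ.+ Q ℤ.+ + 3
    S≤P+Q+3 = subst₂ ℤ._≤_ (e₁ (+ ℓ b) (+ ℓ d) (+ ℓ e) (+ ℓ f)) (e₂ (+ ℓ a) (+ ℓ b) (+ ℓ c) (+ ℓ d) (+ ℓ f))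
      (ℤₚ.+-monoˡ-≤ (ℤ.- (+ ℓ f ℤ.+ (+ ℓ b ℤ.+ + ℓ d))) (ℤ.+≤+ (⌊log₂⌋-product-≤ (suc n) e b d f a c
        (ℕₚ.≤-reflexive (*-cross-multiplied p q)))))
      where
      e₁ : ∀ B D E F → E ℤ.+ (B ℤ.+ D) ℤ.+ ℤ.- (F ℤ.+ (B ℤ.+ D)) ≡ E ℤ.- F
      e₁ = ℤ-solve
      e₂ : ∀ A B C D F → + 1 ℤ.+ F ℤ.+ (+ 1 ℤ.+ A ℤ.+ (+ 1 ℤ.+ C)) ℤ.+ ℤ.- (F ℤ.+ (B ℤ.+ D)) ≡
           A ℤ.- B ℤ.+ (C ℤ.- D) ℤ.+ + 3
      e₂ = ℤ-solve

    P+Q≤S+3 : P ℤ.+ Q ℤ.≤ S ℤ.+ + 3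
    P+Q≤S+3 = subst₂ ℤ._≤_ (e₁ (+ ℓ a) (+ ℓ b) (+ ℓ c) (+ ℓ d) (+ ℓ f)) (e₂ (+ ℓ b) (+ ℓ d) (+ ℓ e) (+ ℓ f))
      (ℤₚ.+-monoˡ-≤ (ℤ.- (+ ℓ f ℤ.+ (+ ℓ b ℤ.+ + ℓ d))) (ℤ.+≤+ (⌊log₂⌋-product-≤ (suc n) f a c e b d
        (ℕₚ.≤-reflexive (≡.sym (*-cross-multiplied p q))))))
      where
      e₁ : ∀ A B C D F → F ℤ.+ (A ℤ.+ C) ℤ.+ ℤ.- (F ℤ.+ (B ℤ.+ D)) ≡ A ℤ.- B ℤ.+ (C ℤ.- D)
      e₁ = ℤ-solve
      e₂ : ∀ B D E F → + 1 ℤ.+ E ℤ.+ (+ 1 ℤ.+ B ℤ.+ (+ 1 ℤ.+ D)) ℤ.+ ℤ.- (F ℤ.+ (B ℤ.+ D)) ≡ E ℤ.- F ℤ.+ + 3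
      e₂ = ℤ-solve

  log₂≈-*-≤ : log₂≈ (p ℚ.* q) n ℚ.≤ log₂≈ p n ℚ.+ log₂≈ q n ℚ.+ 3/1+ n
  log₂≈-*-≤ = begin
    log₂≈ (p ℚ.* q) n                          ≤⟨ /-mono-≤ n S≤P+Q+3 ⟩
    (P ℤ.+ Q ℤ.+ + 3) ℚ./ suc n                ≡⟨ /-homo-+ n (P ℤ.+ Q) (+ 3) ⟩
    (P ℤ.+ Q) ℚ./ suc n ℚ.+ 3/1+ n             ≡⟨ cong (ℚ._+ 3/1+ n) sum-/ ⟩
    log₂≈ p n ℚ.+ log₂≈ q n ℚ.+ 3/1+ n         ∎
    where open ℚₚ.≤-Reasoning

  log₂≈-*-≥ : log₂≈ p n ℚ.+ log₂≈ q n ℚ.≤ log₂≈ (p ℚ.* q) n ℚ.+ 3/1+ n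
  log₂≈-*-≥ = begin
    log₂≈ p n ℚ.+ log₂≈ q n                    ≡⟨ sum-/ ⟨
    (P ℤ.+ Q) ℚ./ suc n                        ≤⟨ /-mono-≤ n P+Q≤S+3 ⟩
    (S ℤ.+ + 3) ℚ./ suc n                      ≡⟨ /-homo-+ n S (+ 3) ⟩
    log₂≈ (p ℚ.* q) n ℚ.+ 3/1+ n               ∎
    where open ℚₚ.≤-Reasoning

-- Wherever both terms are positive the two sides differ by at most `3/1+ n`, which tends to zero.
log₂-* : ∀ {x y} (0<x : 0ℝ < x) (0<y : 0ℝ < y) (0<xy : 0ℝ < x * y) →
         log₂ (x * y) 0<xy ≈ log₂ x 0<x + log₂ y 0<y
log₂-* {x} {y} 0<x 0<y 0<xy = mk≈
    (mk≤ λ ε 0<ε → zipᵉ both-positive (3/1+-eventually-≤ 0<ε) λ n (0<xₙ , 0<yₙ) n≤ →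
      ℚₚ.≤-trans (log₂≈-*-≤ 0<xₙ 0<yₙ n) (ℚₚ.+-monoʳ-≤ (log₂≈ (seq x n) n ℚ.+ log₂≈ (seq y n) n) n≤))
    (mk≤ λ ε 0<ε → zipᵉ both-positive (3/1+-eventually-≤ 0<ε) λ n (0<xₙ , 0<yₙ) n≤ →
      ℚₚ.≤-trans (log₂≈-*-≥ 0<xₙ 0<yₙ n) (ℚₚ.+-monoʳ-≤ (log₂≈ (seq x n ℚ.* seq y n) n) n≤))
  where
  both-positive : Eventually (λ n → 0ℚ ℚ.< seq x n × 0ℚ ℚ.< seq y n)
  both-positive = bothᵉ (eventually-positive 0<x) (eventually-positive 0<y)

-- This carries the inequality between products of vulnerabilities over to entropies without
-- dividing reals.
log₂-*-mono-≤ : ∀ {x y z w} (0<x : 0ℝ < x) (0<y : 0ℝ < y) (0<z : 0ℝ < z) (0<w : 0ℝ < w) →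
                x * y ≤ z * w → log₂ x 0<x + log₂ y 0<y ≤ log₂ z 0<z + log₂ w 0<w
log₂-*-mono-≤ {x} {y} {z} {w} 0<x 0<y 0<z 0<w xy≤zw = begin
    log₂ x 0<x + log₂ y 0<y      ≈⟨ log₂-* 0<x 0<y 0<xy ⟨
    log₂ (x * y) 0<xy            ≲⟨ log₂-mono-≤ 0<xy 0<zw xy≤zw ⟩
    log₂ (z * w) 0<zw            ≈⟨ log₂-* 0<z 0<w 0<zw ⟩
    log₂ z 0<z + log₂ w 0<w      ∎
  where
  open ≤-Reasoning
  0<xy : 0ℝ < x * y
  0<xy = *-positive 0<x 0<y
  0<zw : 0ℝ < z * w
  0<zw = *-positive 0<z 0<w

-- Sums and maxima

sum-nonneg : ∀ {n} {f : Fin n → ℝ} → (∀ i → 0ℝ ≤ f i) → 0ℝ ≤ sum f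
sum-nonneg {zero}  p = ≤-refl
sum-nonneg {suc n} p = ≤-trans (≈⇒≥ (ℝ-ring.+-identityˡ 0ℝ)) (+-mono-≤ (p zero) (sum-nonneg (p ∘ suc)))

-- The products of distinct indices missing on the left are nonnegative. In the induction they are
-- each head times the tail sum of the other family.
sum-diagonal-≤ : ∀ {n} {f h : Fin n → ℝ} → (∀ i → 0ℝ ≤ f i) → (∀ i → 0ℝ ≤ h i) →
                 sum (λ i → f i * h i) ≤ sum f * sum h
sum-diagonal-≤ {zero}          p q = ≈⇒≥ (ℝ-ring.zeroˡ 0ℝ)
sum-diagonal-≤ {suc n} {f} {h} p q = ≤-trans (+-mono-≤ ≤-refl (sum-diagonal-≤ (p ∘ suc) (q ∘ suc)))
  (x+d≈y⇒x≤y
    (≤-trans (≈⇒≥ (ℝ-ring.+-identityˡ 0ℝ))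
      (+-mono-≤ (*-nonneg (p zero) (sum-nonneg (q ∘ suc))) (*-nonneg (sum-nonneg (p ∘ suc)) (q zero))))
    (pointwise⇒≈ λ k → eq (seq (f zero) k) (seq (h zero) k) (seq (sum (f ∘ suc)) k) (seq (sum (h ∘ suc)) k)))
  where
  eq : ∀ a b A B → a ℚ.* b ℚ.+ A ℚ.* B ℚ.+ (a ℚ.* B ℚ.+ A ℚ.* b) ≡ (a ℚ.+ A) ℚ.* (b ℚ.+ B)
  eq = ring-solve ℚ-ring

-- Multiplication by `c` need not distribute over `⊔` termwise, since a nonnegative real may have
-- negative terms. Instead, cases on whether the head or the rest is larger replace the maximum by
-- one of them.
*-max-lub : ∀ {n c b} (f : Fin (suc n) → ℝ) → 0ℝ ≤ c → (∀ i → c * f i ≤ b) → c * max f ≤ b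
*-max-lub {zero}          f 0≤c p = p zero
*-max-lub {suc n} {c} {b} f 0≤c p = ≤-cases (f zero) (max (f ∘ suc))
  (λ f₀<m → ≤-trans (*-monoˡ-≤-nonneg 0≤c (⊔-lub (<⇒≤ f₀<m) ≤-refl)) (*-max-lub (f ∘ suc) 0≤c (p ∘ suc)))
  (λ m≤f₀ → ≤-trans (*-monoˡ-≤-nonneg 0≤c (⊔-lub ≤-refl m≤f₀)) (p zero))

-- Parallel composition

-- A positive `a` is at least the minimum, and multiplying by `a` gives the claim. The extra factor
-- `a` covers the vanishing products, which the minimum does not bound: there `m * a` is at most 0.
minimum-*-≤-square : ∀ {W X} (g : GainFunction W X) (π : Prior X) (m : Minimum (NonzeroProducts g π)) →
  ∀ w x → let a = prob π x * gain g w x in Minimum.value m * a ≤ a * a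
minimum-*-≤-square g π m w x = ≤-cases 0ℝ a
    (λ 0<a → *-mono-≤-nonneg 0≤m 0≤a (Minimum.least m a (x , w , ≈-refl , inj₂ 0<a)) ≤-refl)
    (λ a≤0 → ≤-trans (*-monoˡ-≤-nonneg 0≤m a≤0)
      (≤-trans (≈⇒≤ (ℝ-ring.zeroʳ (Minimum.value m))) (*-nonneg 0≤a 0≤a)))
  where
  a = prob π x * gain g w x
  0≤a : 0ℝ ≤ a
  0≤a = *-nonneg (Prior.nonneg π x) (GainFunction.nonneg g w x)
  0≤m : 0ℝ ≤ Minimum.value m
  0≤m = <⇒≤ (minimum-positive g π m)

module _ {W X : FinSet⁺} (g : GainFunction W X) (π : Prior X) where

  -- `weight`, `score` and `best` name the nested stages of `Vᶜ`, so that `Vᶜ g π C` unfolds to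
  -- `∑ Y (best C)`.
  weight : ∀ {Y} → Channel X Y → Carrier Y → Carrier W → Carrier X → ℝ
  weight C y w x = prob π x * entry C x y * gain g w x

  score : ∀ {Y} → Channel X Y → Carrier Y → Carrier W → ℝ
  score C y w = ∑ X (weight C y w)

  best : ∀ {Y} → Channel X Y → Carrier Y → ℝ
  best C y = Max W (score C y)

  weight-nonneg : ∀ {Y} (C : Channel X Y) y w x → 0ℝ ≤ weight C y w x
  weight-nonneg C y w x =
    *-nonneg (*-nonneg (Prior.nonneg π x) (Channel.nonneg C x y)) (GainFunction.nonneg g w x)

  score-nonneg : ∀ {Y} (C : Channel X Y) y w → 0ℝ ≤ score C y w
  score-nonneg C y w = sum-nonneg λ i → weight-nonneg C y w (elem X i)

  score≤best : ∀ {Y} (C : Channel X Y) y i → score C y (elem W i) ≤ best C y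
  score≤best C y = f≤max (score C y ∘ elem W)

  best-nonneg : ∀ {Y} (C : Channel X Y) y → 0ℝ ≤ best C y
  -- `W` is nonempty, so index `zero` supplies a score below the maximum.
  best-nonneg C y = ≤-trans (score-nonneg C y (elem W zero)) (score≤best C y zero)

  module _ {Y₁ Y₂ : FinSet⁺} (C₁ : Channel X Y₁) (C₂ : Channel X Y₂)
           (m : Minimum (NonzeroProducts g π)) where
    private
      v : ℝ
      v = Minimum.value m
      0≤v : 0ℝ ≤ v
      0≤v = <⇒≤ (minimum-positive g π m)

    -- With the nonnegative factor `c₁ * c₂` pulled out, what remains is `minimum-*-≤-square`.
    weight-∥-≤ : ∀ y₁ y₂ w x →
      v * weight (C₁ ∥ C₂) (y₁ , y₂) w x ≤ weight C₁ y₁ w x * weight C₂ y₂ w x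
    weight-∥-≤ y₁ y₂ w x = begin
        v * (p * (c₁ * c₂) * h)          ≈⟨ pointwise⇒≈ (λ n → eq₁ (seq v n) (seq p n) (seq c₁ n) (seq c₂ n) (seq h n)) ⟩
        c₁ * c₂ * (v * (p * h))          ≲⟨ *-monoˡ-≤-nonneg (*-nonneg (Channel.nonneg C₁ x y₁) (Channel.nonneg C₂ x y₂))
                                              (minimum-*-≤-square g π m w x) ⟩
        c₁ * c₂ * (p * h * (p * h))      ≈⟨ pointwise⇒≈ (λ n → eq₂ (seq p n) (seq c₁ n) (seq c₂ n) (seq h n)) ⟩
        p * c₁ * h * (p * c₂ * h)        ∎
      where
      open ≤-Reasoning
      p = prob π x
      h = gain g w x
      c₁ = entry C₁ x y₁
      c₂ = entry C₂ x y₂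
      eq₁ : ∀ v p c d h → v ℚ.* (p ℚ.* (c ℚ.* d) ℚ.* h) ≡ c ℚ.* d ℚ.* (v ℚ.* (p ℚ.* h))
      eq₁ = ring-solve ℚ-ring
      eq₂ : ∀ p c d h → c ℚ.* d ℚ.* (p ℚ.* h ℚ.* (p ℚ.* h)) ≡ p ℚ.* c ℚ.* h ℚ.* (p ℚ.* d ℚ.* h)
      eq₂ = ring-solve ℚ-ring

    score-∥-≤ : ∀ y₁ y₂ w → v * score (C₁ ∥ C₂) (y₁ , y₂) w ≤ score C₁ y₁ w * score C₂ y₂ w
    score-∥-≤ y₁ y₂ w = begin
        v * score (C₁ ∥ C₂) (y₁ , y₂) w                            ≈⟨ *-distribˡ-sum v (weight (C₁ ∥ C₂) (y₁ , y₂) w ∘ elem X) ⟩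
        ∑ X (λ x → v * weight (C₁ ∥ C₂) (y₁ , y₂) w x)             ≲⟨ sum-mono (λ i → weight-∥-≤ y₁ y₂ w (elem X i)) ⟩
        ∑ X (λ x → weight C₁ y₁ w x * weight C₂ y₂ w x)            ≲⟨ sum-diagonal-≤ (λ i → weight-nonneg C₁ y₁ w (elem X i))
                                                                        (λ i → weight-nonneg C₂ y₂ w (elem X i)) ⟩
        score C₁ y₁ w * score C₂ y₂ w                              ∎
      where open ≤-Reasoning

    -- For each `w` on the left, both scores on the right are taken at that same `w`; each is then
    -- bounded by its own maximum.
    best-∥-≤ : ∀ y₁ y₂ → v * best (C₁ ∥ C₂) (y₁ , y₂) ≤ best C₁ y₁ * best C₂ y₂
    best-∥-≤ y₁ y₂ = *-max-lub (score (C₁ ∥ C₂) (y₁ , y₂) ∘ elem W) 0≤v λ i →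
      ≤-trans (score-∥-≤ y₁ y₂ (elem W i))
        (*-mono-≤-nonneg (score-nonneg C₁ y₁ (elem W i)) (best-nonneg C₂ y₂)
          (score≤best C₁ y₁ i) (score≤best C₂ y₂ i))

    -- The bound from `best-∥-≤` separates `y₁` from `y₂`, so its sum over pairs factors.
    Vᶜ-∥-≤ : v * Vᶜ g π (C₁ ∥ C₂) ≤ Vᶜ g π C₁ * Vᶜ g π C₂
    Vᶜ-∥-≤ = begin
        v * Vᶜ g π (C₁ ∥ C₂)
          ≈⟨ *-distribˡ-sum v (best (C₁ ∥ C₂) ∘ elem (Y₁ ×ᶠ Y₂)) ⟩
        ∑ (Y₁ ×ᶠ Y₂) (λ y → v * best (C₁ ∥ C₂) y)
          ≲⟨ sum-mono (λ k → best-∥-≤ (proj₁ (elem (Y₁ ×ᶠ Y₂) k)) (proj₂ (elem (Y₁ ×ᶠ Y₂) k))) ⟩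
        ∑ (Y₁ ×ᶠ Y₂) (λ y → best C₁ (proj₁ y) * best C₂ (proj₂ y))
          ≈⟨ ∑-× Y₁ Y₂ (λ y₁ y₂ → best C₁ y₁ * best C₂ y₂) ⟩
        ∑ Y₁ (λ y₁ → ∑ Y₂ (λ y₂ → best C₁ y₁ * best C₂ y₂))
          ≈⟨ sum-cong-≋ (λ i → *-distribˡ-sum (best C₁ (elem Y₁ i)) (best C₂ ∘ elem Y₂)) ⟨
        ∑ Y₁ (λ y₁ → best C₁ y₁ * Vᶜ g π C₂)
          ≈⟨ *-distribʳ-sum (Vᶜ g π C₂) (best C₁ ∘ elem Y₁) ⟨
        Vᶜ g π C₁ * Vᶜ g π C₂ ∎
      where open ≤-Reasoning

theorem3p13 : ∀ (X Y₁ Y₂ W : FinSet⁺)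
    (g : GainFunction W X)
    (π : Prior X) (V>0 : 0ℝ < V g π)
    (C₁ : Channel X Y₁) (C₂ : Channel X Y₂)
    (m : Minimum (NonzeroProducts g π)) →
    I g π V>0 (C₁ ∥ C₂) ≤ I g π V>0 C₁ + I g π V>0 C₂ + Hᵐⁱⁿ g π m - H g π V>0
theorem3p13 X Y₁ Y₂ W g π V>0 C₁ C₂ m = begin
    -- Both sides contain the common remainder `- L - Lₘ`; splitting it off leaves the logarithmic
    -- form of `Vᶜ-∥-≤`.
    - L - - L₁₂                                ≈⟨ pointwise⇒≈ (λ n → eq₁ (seq L n) (seq L₁₂ n) (seq Lₘ n)) ⟩
    Lₘ + L₁₂ + (- L - Lₘ)                      ≲⟨ +-mono-≤ logs ≤-refl ⟩
    L₁ + L₂ + (- L - Lₘ)                       ≈⟨ pointwise⇒≈ (λ n → eq₂ (seq L n) (seq L₁ n) (seq L₂ n) (seq Lₘ n)) ⟩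
    - L - - L₁ + (- L - - L₂) + - Lₘ - - L     ∎
  where
  open ≤-Reasoning
  0<V : ∀ {Y} (C : Channel X Y) → 0ℝ < Vᶜ g π C
  0<V C = Vᶜ-positive g π C V>0
  L   = log₂ (V g π) V>0
  L₁  = log₂ (Vᶜ g π C₁) (0<V C₁)
  L₂  = log₂ (Vᶜ g π C₂) (0<V C₂)
  L₁₂ = log₂ (Vᶜ g π (C₁ ∥ C₂)) (0<V (C₁ ∥ C₂))
  Lₘ  = log₂ (Minimum.value m) (minimum-positive g π m)
  logs : Lₘ + L₁₂ ≤ L₁ + L₂
  logs = log₂-*-mono-≤ (minimum-positive g π m) (0<V (C₁ ∥ C₂)) (0<V C₁) (0<V C₂) (Vᶜ-∥-≤ g π C₁ C₂ m)
  eq₁ : ∀ l l₁₂ lₘ → ℚ.- l ℚ.- ℚ.- l₁₂ ≡ lₘ ℚ.+ l₁₂ ℚ.+ (ℚ.- l ℚ.- lₘ)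
  eq₁ = ring-solve ℚ-ring
  eq₂ : ∀ l l₁ l₂ lₘ → l₁ ℚ.+ l₂ ℚ.+ (ℚ.- l ℚ.- lₘ) ≡
                       ℚ.- l ℚ.- ℚ.- l₁ ℚ.+ (ℚ.- l ℚ.- ℚ.- l₂) ℚ.+ ℚ.- lₘ ℚ.- ℚ.- l
  eq₂ = ring-solve ℚ-ring
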